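{- The safety problem for TSO games with process fairness is undecidable: there is no algorithm that, given a concurrent program $\mathcal{P}$, a set $F$ of local states and an initial TSO configuration $c_0$, decides whether the process player wins the TSO game $\mathcal{G}(\mathcal{P})$ from $(c_0)_A$ with respect to the winning condition $W_{SP}=W_S\cap W_P$.
   Context: Let $V$ be a finite data domain and $X$ a finite set of shared variables over $V$. Instructions are $\mathrm{rd}(x,d)$, $\mathrm{wr}(x,d)$ ($x\in X,d\in V$), $\mathrm{skip}$, $\mathrm{mf}$. A process is a finite labelled transition system $\langle Q,\mathrm{Instrs},\delta\rangle$; a concurrent program is a tuple $\mathcal{P}=\langle P^\iota\rangle_{\iota\in I}$, $I$ finite. A TSO configuration is $c=\langle s,b,m\rangle$ with $s(\iota)\in Q^\iota$, FIFO buffers $b(\iota)\in(X\times V)^*$ (new messages on the left, oldest on the right), memory $m:X\to V$. TSO transitions: $\mathrm{rd}(x,d)$ of process $\iota$ is enabled if the most recent message on $x$ in $b(\iota)$ is $\langle x,d\rangle$, or if $b(\iota)$ has no message on $x$ and $m(x)=d$; $\mathrm{wr}(x,d)$ prepends $\langle x,d\rangle$ to $b(\iota)$; $\mathrm{skip}$ changes only the local state; $\mathrm{mf}$ is enabled only if $b(\iota)=\varepsilon$; an update of $\iota$ removes the oldest message $\langle x,d\rangle$ from $b(\iota)$ and sets $m(x)=d$. A game $\langle C,C_A,C_B,\to\rangle$: a play is an infinite sequence of moves, or a finite one ending in a configuration with no successors; a winning condition is a set of infinite plays; player A wins an infinite play in the winning condition or a finite play ending in $C_B$; otherwise B wins;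 a configuration is winning for A if A has a strategy winning against every strategy of B. The TSO game $\mathcal{G}(\mathcal{P})$: $C_A,C_B$ are copies of the TSO configurations; the process player (A) moves $c_A\to c'_B$ along any instruction transition of any process; the update player (B) moves $c_B\to c'_A$ for every $c'$ obtained from $c$ by zero or more updates. For a set $F$ of local states, $C_F$ is the set of game configurations where some process is in a state of $F$ (with $c_0\notin C_F$); $W_S$ is the set of plays never visiting $C_F$. Process fairness: $W_P$ is the set of plays $c_0,c_1,\dots$ such that for every $\iota\in I$, if there are infinitely many $k$ with $c_k\in C_A$ at which some instruction of process $\iota$ is enabled, then there are infinitely many $k'$ with $c_{k'}\in C_A$ such that the move $c_{k'}\to c_{k'+1}$ is an instruction of process $\iota$. -}

module Defs where

open import Data.Nat using (ℕ; zero; suc; _+_; _*_; _/_; _≤_; _<_)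
open import Data.Fin as Fin using (Fin; toℕ)
open import Data.Bool using (Bool; true; false; if_then_else_)
open import Data.List using (List; []; _∷_; _++_; [_]; map)
open import Data.Vec as Vec using (Vec; []; _∷_; lookup; _[_]≔_; toList)
open import Data.Maybe using (Maybe; just; nothing; maybe′)
open import Data.Product using (Σ; ∃; _×_; _,_; proj₁; proj₂)
open import Data.Sum using (_⊎_)
open import Data.Unit using (⊤)
open import Data.Empty using (⊥)
open import Data.List.Membership.Propositional using (_∈_)
open import Relation.Nullary using (¬_; yes; no)
open import Relation.Binary.PropositionalEquality using (_≡_; refl)
open import Relation.Binary.Construct.Closure.ReflexiveTransitive using (Star)

-- Programs (syntax).  Data domain V = Fin nV, variables X = Fin nX.

data Instr (nX nV : ℕ) : Set where
  rd   : Fin nX → Fin nV → Instr nX nV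
  wr   : Fin nX → Fin nV → Instr nX nV
  skip : Instr nX nV
  mf   : Instr nX nV

record Process (nX nV : ℕ) : Set where
  constructor process
  field
    nQ : ℕ
    δ  : List (Fin nQ × Instr nX nV × Fin nQ)

open Process public

data PerProc {nX nV : ℕ} (P : Process nX nV → Set) :
             {nI : ℕ} → Vec (Process nX nV) nI → Set where
  []  : PerProc P []
  _∷_ : ∀ {nI p} {ps : Vec (Process nX nV) nI} →
        P p → PerProc P ps → PerProc P (p ∷ ps)

plookup : ∀ {nX nV nI} {P : Process nX nV → Set} {ps : Vec (Process nX nV) nI} →
          PerProc P ps → (ι : Fin nI) → P (lookup ps ι)
plookup (x ∷ xs) Fin.zero    = x
plookup (x ∷ xs) (Fin.suc ι) = plookup xs ι

pset : ∀ {nX nV nI} {P : Process nX nV → Set} {ps : Vec (Process nX nV) nI} →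
       PerProc P ps → (ι : Fin nI) → P (lookup ps ι) → PerProc P ps
pset (x ∷ xs) Fin.zero    y = y ∷ xs
pset (x ∷ xs) (Fin.suc ι) y = x ∷ pset xs ι y

LocalState : ∀ {nX nV} → Process nX nV → Set
LocalState p = Fin (nQ p)

StateSet : ∀ {nX nV} → Process nX nV → Set
StateSet p = Vec Bool (nQ p)          -- characteristic vector of a subset of Q

-- TSO configurations ⟨s , b , m⟩.  Buffers: newest message on the left.
record Config {nX nV nI : ℕ} (prog : Vec (Process nX nV) nI) : Set where
  constructor ⟨_,_,_⟩
  field
    s : PerProc LocalState prog
    b : Vec (List (Fin nX × Fin nV)) nI
    m : Vec (Fin nV) nX

open Config public

record Instance : Set where
  field
    nV nX nI : ℕ
    prog     : Vec (Process nX nV) nI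
    F        : PerProc StateSet prog
    c₀       : Config prog

module TSO {nX nV nI : ℕ} (prog : Vec (Process nX nV) nI) where

  Conf : Set
  Conf = Config prog

  Trans : Fin nI → Set
  Trans ι = Fin (nQ (lookup prog ι)) × Instr nX nV × Fin (nQ (lookup prog ι))

  latest : Fin nX → List (Fin nX × Fin nV) → Maybe (Fin nV)
  latest x [] = nothing
  latest x ((y , d) ∷ bs) with x Fin.≟ y
  ... | yes _ = just d
  ... | no  _ = latest x bs

  readVal : Conf → Fin nI → Fin nX → Fin nV
  readVal c ι x = maybe′ (λ d → d) (lookup (m c) x) (latest x (lookup (b c) ι))

  Enabled : Conf → (ι : Fin nI) → Instr nX nV → Set
  Enabled c ι (rd x d) = readVal c ι x ≡ d
  Enabled c ι (wr x d) = ⊤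
  Enabled c ι skip     = ⊤
  Enabled c ι mf       = lookup (b c) ι ≡ []

  exec : Conf → (ι : Fin nI) → Instr nX nV → Fin (nQ (lookup prog ι)) → Conf
  exec c ι (wr x d) q′ = ⟨ pset (s c) ι q′ , b c [ ι ]≔ ((x , d) ∷ lookup (b c) ι) , m c ⟩
  exec c ι _        q′ = ⟨ pset (s c) ι q′ , b c , m c ⟩

  ProcEnabled : Conf → Fin nI → Set
  ProcEnabled c ι = Σ (Trans ι) λ { (q , i , q′) →
    (q , i , q′) ∈ δ (lookup prog ι) × q ≡ plookup (s c) ι × Enabled c ι i }

  ProcStep : Conf → Fin nI → Conf → Set
  ProcStep c ι c′ = Σ (Trans ι) λ { (q , i , q′) →
    (q , i , q′) ∈ δ (lookup prog ι) × q ≡ plookup (s c) ι × Enabled c ι i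
    × c′ ≡ exec c ι i q′ }

  Update : Conf → Conf → Set
  Update c c′ = Σ (Fin nI) λ ι → Σ (List (Fin nX × Fin nV)) λ bs →
    Σ (Fin nX) λ x → Σ (Fin nV) λ d →
      lookup (b c) ι ≡ bs ++ [ (x , d) ] ×
      c′ ≡ ⟨ s c , b c [ ι ]≔ bs , m c [ x ]≔ d ⟩

  data Player : Set where
    A B : Player

  GConf : Set
  GConf = Player × Conf

  Move : GConf → GConf → Set
  Move (A , c) (B , c′) = Σ (Fin nI) λ ι → ProcStep c ι c′
  Move (B , c) (A , c′) = Star Update c c′
  Move _       _        = ⊥

  -- a (deterministic, history dependent) strategy: given the history
  -- (previous configurations, most recent first) and the current
  -- configuration, choose the next configuration
  Strategy : Set
  Strategy = List GConf → GConf → GConf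

  Legal : Player → Strategy → Set
  Legal p σ = ∀ h c → proj₁ c ≡ p → (∃ λ c′ → Move c c′) → Move c (σ h c)

  hist : (ℕ → GConf) → ℕ → List GConf
  hist π zero    = []
  hist π (suc k) = π k ∷ hist π k

  choose : Strategy → Strategy → List GConf → GConf → GConf
  choose σA σB h (A , c) = σA h (A , c)
  choose σA σB h (B , c) = σB h (B , c)

  InfOutcome : Strategy → Strategy → GConf → (ℕ → GConf) → Set
  InfOutcome σA σB g₀ π =
    π 0 ≡ g₀ × (∀ k → Move (π k) (π (suc k)))
             × (∀ k → π (suc k) ≡ choose σA σB (hist π k) (π k))

  FinOutcome : Strategy → Strategy → GConf → ℕ → (ℕ → GConf) → Set
  FinOutcome σA σB g₀ n π =
    π 0 ≡ g₀ × (∀ k → k < n → Move (π k) (π (suc k)))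
             × (∀ k → k < n → π (suc k) ≡ choose σA σB (hist π k) (π k))
             × ¬ (∃ λ g → Move (π n) g)

  WinCond : Set₁
  WinCond = (ℕ → GConf) → Set

  AWins : WinCond → GConf → Set
  AWins W g₀ = Σ Strategy λ σA → Legal A σA × (∀ σB → Legal B σB →
      (∀ π → InfOutcome σA σB g₀ π → W π)
    × (∀ n π → FinOutcome σA σB g₀ n π → proj₁ (π n) ≡ B))

  InCF : PerProc StateSet prog → GConf → Set
  InCF F (_ , c) = Σ (Fin nI) λ ι → lookup (plookup F ι) (plookup (s c) ι) ≡ true

  W-S : PerProc StateSet prog → WinCond
  W-S F π = ∀ k → ¬ InCF F (π k)

  InfinitelyOften : (ℕ → Set) → Set
  InfinitelyOften P = ∀ n → Σ ℕ λ k → n ≤ k × P k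

  W-P : WinCond
  W-P π = ∀ ι →
    InfinitelyOften (λ k → proj₁ (π k) ≡ A × ProcEnabled (proj₂ (π k)) ι) →
    InfinitelyOften (λ k → proj₁ (π k) ≡ A × ProcStep (proj₂ (π k)) ι (proj₂ (π (suc k))))

  W-SP : PerProc StateSet prog → WinCond
  W-SP F π = W-S F π × W-P π

SafetyFair : Instance → Set
SafetyFair I = TSO.AWins prog (TSO.W-SP prog F) (TSO.A , c₀)
  where open Instance I

data Rec : ℕ → Set where
  zer  : ∀ {n} → Rec n
  succ : Rec 1
  proj : ∀ {n} → Fin n → Rec n
  comp : ∀ {n k} → Rec k → Vec (Rec n) k → Rec n
  prec : ∀ {n} → Rec n → Rec (suc (suc n)) → Rec (suc n)
  mu   : ∀ {n} → Rec (suc n) → Rec n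

mutual
  data _[_]⇓_ : ∀ {n} → Rec n → Vec ℕ n → ℕ → Set where
    ev-zer  : ∀ {n} {xs : Vec ℕ n} → zer [ xs ]⇓ 0
    ev-succ : ∀ {x} → succ [ x ∷ [] ]⇓ suc x
    ev-proj : ∀ {n} {xs : Vec ℕ n} i → proj i [ xs ]⇓ lookup xs i
    ev-comp : ∀ {n k} {f : Rec k} {gs : Vec (Rec n) k} {xs ys y} →
              gs [ xs ]⇓* ys → f [ ys ]⇓ y → comp f gs [ xs ]⇓ y
    ev-prec0 : ∀ {n} {g : Rec n} {h} {xs y} →
              g [ xs ]⇓ y → prec g h [ 0 ∷ xs ]⇓ y
    ev-precS : ∀ {n} {g : Rec n} {h} {xs k r y} →
              prec g h [ k ∷ xs ]⇓ r → h [ k ∷ r ∷ xs ]⇓ y →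
              prec g h [ suc k ∷ xs ]⇓ y
    ev-mu   : ∀ {n} {f : Rec (suc n)} {xs y} →
              f [ y ∷ xs ]⇓ 0 →
              (∀ z → z < y → Σ ℕ λ v → f [ z ∷ xs ]⇓ suc v) →
              mu f [ xs ]⇓ y

  data _[_]⇓*_ : ∀ {n k} → Vec (Rec n) k → Vec ℕ n → Vec ℕ k → Set where
    []  : ∀ {n} {xs : Vec ℕ n} → [] [ xs ]⇓* []
    _∷_ : ∀ {n k} {g : Rec n} {gs : Vec (Rec n) k} {xs y ys} →
          g [ xs ]⇓ y → gs [ xs ]⇓* ys → (g ∷ gs) [ xs ]⇓* (y ∷ ys)

-- Cantor pairing
⟪_,_⟫ : ℕ → ℕ → ℕ
⟪ a , b ⟫ = ((a + b) * suc (a + b)) / 2 + b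

encList : List ℕ → ℕ
encList []       = 0
encList (x ∷ xs) = suc ⟪ x , encList xs ⟫

encBool : Bool → ℕ
encBool false = 0
encBool true  = 1

encInstr : ∀ {nX nV} → Instr nX nV → ℕ
encInstr (rd x d) = ⟪ 0 , ⟪ toℕ x , toℕ d ⟫ ⟫
encInstr (wr x d) = ⟪ 1 , ⟪ toℕ x , toℕ d ⟫ ⟫
encInstr skip     = ⟪ 2 , 0 ⟫
encInstr mf       = ⟪ 3 , 0 ⟫

encProcess : ∀ {nX nV} → Process nX nV → ℕ
encProcess p = ⟪ nQ p , encList (map (λ { (q , i , q′) → ⟪ toℕ q , ⟪ encInstr i , toℕ q′ ⟫ ⟫ }) (δ p)) ⟫

encPer : ∀ {nX nV nI} {P : Process nX nV → Set} {ps : Vec (Process nX nV) nI} →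
         (∀ {p} → P p → ℕ) → PerProc P ps → List ℕ
encPer e []       = []
encPer e (x ∷ xs) = e x ∷ encPer e xs

encode : Instance → ℕ
encode I = encList
  ( nV ∷ nX ∷ nI
  ∷ encList (toList (Vec.map encProcess prog))
  ∷ encList (encPer (λ v → encList (toList (Vec.map encBool v))) F)
  ∷ encList (encPer toℕ (s c₀))
  ∷ encList (toList (Vec.map (λ bs → encList (map (λ { (x , d) → ⟪ toℕ x , toℕ d ⟫ }) bs)) (b c₀)))
  ∷ encList (toList (Vec.map toℕ (m c₀)))
  ∷ [])
  where open Instance I

Decidable : (Instance → Set) → Set
Decidable P = Σ (Rec 1) λ f → ∀ I →
  (f [ encode I ∷ [] ]⇓ 1 × P I) ⊎ (f [ encode I ∷ [] ]⇓ 0 × ¬ P I)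

{-# OPTIONS --safe #-}

-- A queue machine is turned into a game of three processes.  The sender runs the finite
-- control and its store buffer is the queue; the receiver takes the messages that reach
-- the memory and hands them back to the sender through z; the idler only skips.  The
-- update player alone decides when messages reach the memory.  Delivering too many of
-- them is noticed by the receiver, which then retires, and delivering none leaves the
-- process player idling, so in both cases the process player survives.  In turn, process
-- fairness forbids the process player to stop simulating.  Hence the process player wins
-- iff the machine never halts.  Queue machines execute register programs and these
-- compute all recursive functions, so that a decision procedure could be composed with
-- the computation of the code of a game into a program whose own game it judges wrongly.
module Submission where

open import Defs
open import Data.Bool using (Bool; true; false; if_then_else_; not; _∧_)
open import Data.Empty using (⊥; ⊥-elim)
open import Data.Fin as Fin using (Fin; zero; suc; toℕ; fromℕ; inject₁)
import Data.Fin.Properties as Fin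
open import Data.List using (List; []; _∷_; _++_; [_]; _∷ʳ_; InitLast; initLast; _∷ʳ′_; length; map; concatMap; allFin; replicate)
open import Data.List.Membership.Propositional using (_∈_; find; lose)
open import Data.List.Membership.Propositional.Properties using (∈-concatMap⁺; ∈-concatMap⁻; ∈-map⁺; ∈-map⁻; ∈-allFin)
open import Data.List.Properties using (++-assoc; ++-identityʳ; ∷-injectiveʳ; ∷ʳ-injective)
open import Data.List.Relation.Unary.All using (All; []; _∷_)
import Data.List.Relation.Unary.All.Properties as All
open import Data.List.Relation.Unary.Any as Any using (here; there; any?)
open import Data.Maybe using (Maybe; just; nothing; maybe′)
open import Data.Maybe.Properties using (just-injective)
open import Data.Nat using (ℕ; zero; suc; _+_; _*_; _∸_; _/_; _⊔_; _≤_; _<_; _≟_; s≤s; z≤n)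
open import Data.Nat.DivMod using (m*n/n≡m)
open import Data.Nat.Properties
open import Data.Nat.Solver using (module +-*-Solver)
open import Data.Product using (Σ; ∃; _×_; _,_; proj₁; proj₂)
open import Data.Sum using (_⊎_; inj₁; inj₂)
open import Data.Unit using (⊤; tt)
open import Data.Vec as Vec using (Vec; []; _∷_; lookup; _[_]≔_)
open import Data.Vec.Properties using (lookup∘tabulate; lookup-replicate)
open import Data.Vec.Relation.Binary.Pointwise.Inductive as PW using (Pointwise; []; _∷_)
open import Function using (_∘_)
open import Relation.Binary.Construct.Closure.ReflexiveTransitive using (Star; ε; _◅_; _◅◅_)
open import Relation.Binary.PropositionalEquality using (_≡_; _≢_; refl; sym; ≢-sym; trans; cong; cong₂; subst; subst₂; module ≡-Reasoning)
open import Relation.Nullary using (¬_; Dec; yes; no; does)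
open import Relation.Nullary.Decidable using (dec-true; dec-false; map′; _×-dec_)


-- Computing codes by recursive functions

-- The update player may release several messages at once, and a release can destroy a value that
-- nobody has read. Hence a letter is split into a write to `x₀` and a write to `x₁`: the buffer is
-- FIFO, so deliveries alternate between the variables, and an excess delivery leaves its trace on
-- the variable that is not being consumed. The receiver resets one variable, fences, and tests the
-- other; if that is still zero, the reset erased nothing but the consumed message.
--
-- The process player must be fair as well, without choosing when messages arrive. Giving the sender
-- priority makes each handover through `z` safe, and it starves nobody, since a machine sends
-- boundedly many letters between two receives.
--
-- For self-reference, a program can hardly contain the code of its own game as a constant, because
-- the constant enlarges the program. Here the processes are fixed first, and their codes are put
-- into registers, that is, into the initial buffer. The code of this buffer is computable from the
-- numbers that it stores in unary, so the program can compute the code of the whole game.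

Computes : ∀ {n} → Rec n → (Vec ℕ n → ℕ) → Set
Computes f F = ∀ xs → f [ xs ]⇓ F xs

subst⇓ : ∀ {n} {f : Rec n} {xs y y′} → f [ xs ]⇓ y → y ≡ y′ → f [ xs ]⇓ y′
subst⇓ e refl = e

constR : ∀ {n} → ℕ → Rec n
constR zero    = zer
constR (suc k) = comp succ (constR k ∷ [])

constR-computes : ∀ {n} k → Computes {n} (constR k) (λ _ → k)
constR-computes zero    xs = ev-zer
constR-computes (suc k) xs = ev-comp (constR-computes k xs ∷ []) ev-succ

comp₂ : ∀ {n} {f : Rec 2} {F : ℕ → ℕ → ℕ} {g h : Rec n} {G H : Vec ℕ n → ℕ} →
        (∀ x y → f [ x ∷ y ∷ [] ]⇓ F x y) → Computes g G → Computes h H →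
        Computes (comp f (g ∷ h ∷ [])) (λ xs → F (G xs) (H xs))
comp₂ cf cg ch xs = ev-comp (cg xs ∷ ch xs ∷ []) (cf _ _)

addR : Rec 2
addR = prec (proj zero) (comp succ (proj (suc zero) ∷ []))

addR-computes : ∀ x y → addR [ x ∷ y ∷ [] ]⇓ (x + y)
addR-computes zero    y = ev-prec0 (ev-proj zero)
addR-computes (suc x) y =
  ev-precS (addR-computes x y) (ev-comp (ev-proj (suc zero) ∷ []) ev-succ)

-- Triangular numbers replace the division by 2 in the Cantor pairing by a primitive recursion.
triangle : ℕ → ℕ
triangle zero    = 0
triangle (suc n) = suc (n + triangle n)

triR : Rec 1
triR = prec zer (comp succ (comp addR (proj zero ∷ proj (suc zero) ∷ []) ∷ []))

triR-computes : ∀ n → triR [ n ∷ [] ]⇓ triangle n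
triR-computes zero    = ev-prec0 ev-zer
triR-computes (suc n) = ev-precS (triR-computes n)
  (ev-comp (ev-comp (ev-proj zero ∷ ev-proj (suc zero) ∷ []) (addR-computes _ _) ∷ []) ev-succ)

triangle-double : ∀ n → n * suc n ≡ triangle n * 2
triangle-double zero    = refl
triangle-double (suc n) = begin
  suc n * suc (suc n)      ≡⟨ solve 1 (λ n → (con 1 :+ n) :* (con 2 :+ n) := n :* (con 1 :+ n) :+ (con 2 :+ n :+ n)) refl n ⟩
  n * suc n + (2 + n + n)  ≡⟨ cong (_+ (2 + n + n)) (triangle-double n) ⟩
  triangle n * 2 + (2 + n + n) ≡⟨ solve 2 (λ n t → t :* con 2 :+ (con 2 :+ n :+ n) := (con 1 :+ (n :+ t)) :* con 2) refl n (triangle n) ⟩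
  triangle (suc n) * 2     ∎
  where open ≡-Reasoning
        open +-*-Solver

pairR : Rec 2
pairR = comp addR (comp triR (comp addR (proj zero ∷ proj (suc zero) ∷ []) ∷ []) ∷ proj (suc zero) ∷ [])

pairR-computes : ∀ a b → pairR [ a ∷ b ∷ [] ]⇓ ⟪ a , b ⟫
pairR-computes a b = subst⇓
  (ev-comp (ev-comp (ev-comp (ev-proj zero ∷ ev-proj (suc zero) ∷ []) (addR-computes _ _) ∷ []) (triR-computes (a + b)) ∷ ev-proj (suc zero) ∷ [])
           (addR-computes _ _))
  (cong (_+ b) (sym (trans (cong (_/ 2) (triangle-double (a + b))) (m*n/n≡m (triangle (a + b)) 2))))

consR : Rec 2
consR = comp succ (pairR ∷ [])

consR-computes : ∀ a b → consR [ a ∷ b ∷ [] ]⇓ suc ⟪ a , b ⟫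
consR-computes a b = ev-comp (pairR-computes a b ∷ []) ev-succ

listR : ∀ {n k} → Vec (Rec n) k → Rec n
listR []       = zer
listR (f ∷ fs) = comp consR (f ∷ listR fs ∷ [])

listR-computes : ∀ {n k} {fs : Vec (Rec n) k} {xs} {ys : Vec ℕ k} → fs [ xs ]⇓* ys →
                 listR fs [ xs ]⇓ encList (Vec.toList ys)
listR-computes []       = ev-zer
listR-computes (e ∷ es) = ev-comp (e ∷ listR-computes es ∷ []) (consR-computes _ _)

-- In the code of a buffer each queue letter contributes two list cells, so a unary block is an
-- iterated double cons onto the code `t` of the older messages.
push₂ : ℕ → ℕ → ℕ → ℕ → ℕ
push₂ a b zero    t = t
push₂ a b (suc n) t = suc ⟪ a , suc ⟪ b , push₂ a b n t ⟫ ⟫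

push₂R : ℕ → ℕ → Rec 2
push₂R a b = prec (proj zero) (comp consR (constR a ∷ comp consR (constR b ∷ proj (suc zero) ∷ []) ∷ []))

push₂R-computes : ∀ a b n t → push₂R a b [ n ∷ t ∷ [] ]⇓ push₂ a b n t
push₂R-computes a b zero    t = ev-prec0 (ev-proj zero)
push₂R-computes a b (suc n) t = ev-precS (push₂R-computes a b n t)
  (comp₂ consR-computes (constR-computes a) (comp₂ consR-computes (constR-computes b) (λ _ → ev-proj (suc zero))) _)

-- Compiling recursive functions to register programs

infixr 5 _⨟_

-- While register r is nonzero, loop r c decrements r and then runs c.
data Cmd : Set where
  inc  : ℕ → Cmd
  nop  : Cmd
  _⨟_  : Cmd → Cmd → Cmd
  loop : ℕ → Cmd → Cmd

Store : Set
Store = ℕ → ℕ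

_[_↦_] : Store → ℕ → ℕ → Store
(ρ [ r ↦ v ]) s with s ≟ r
... | yes _ = v
... | no  _ = ρ s

update-same : ∀ ρ r v → (ρ [ r ↦ v ]) r ≡ v
update-same ρ r v with r ≟ r
... | yes _ = refl
... | no r≢r = ⊥-elim (r≢r refl)

update-other : ∀ ρ {r s} v → s ≢ r → (ρ [ r ↦ v ]) s ≡ ρ s
update-other ρ {r} {s} v s≢r with s ≟ r
... | yes s≡r = ⊥-elim (s≢r s≡r)
... | no _ = refl

data Exec : Cmd → Store → Store → Set where
  inc    : ∀ {r ρ} → Exec (inc r) ρ (ρ [ r ↦ suc (ρ r) ])
  nop    : ∀ {ρ} → Exec nop ρ ρ
  _⨟_    : ∀ {c d ρ ρ′ ρ″} → Exec c ρ ρ′ → Exec d ρ′ ρ″ → Exec (c ⨟ d) ρ ρ″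
  exit   : ∀ {r c ρ} → ρ r ≡ 0 → Exec (loop r c) ρ ρ
  repeat : ∀ {r c ρ ρ′ ρ″ n} → ρ r ≡ suc n → Exec c (ρ [ r ↦ n ]) ρ′ →
           Exec (loop r c) ρ′ ρ″ → Exec (loop r c) ρ ρ″

clear : ℕ → Cmd
clear r = loop r nop

clear-correct : ∀ r ρ → Σ Store λ ρ′ → Exec (clear r) ρ ρ′ × ρ′ r ≡ 0 × (∀ s → s ≢ r → ρ′ s ≡ ρ s)
clear-correct r ρ = go (ρ r) ρ refl
  where
  go : ∀ n ρ → ρ r ≡ n → Σ Store λ ρ′ → Exec (clear r) ρ ρ′ × ρ′ r ≡ 0 × (∀ s → s ≢ r → ρ′ s ≡ ρ s)
  go zero    ρ eq = ρ , exit eq , eq , λ _ _ → refl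
  go (suc n) ρ eq =
    let ρ′ , run , ρ′r , same = go n (ρ [ r ↦ n ]) (update-same ρ r n)
    in ρ′ , repeat eq nop run , ρ′r , λ s s≢r → trans (same s s≢r) (update-other ρ n s≢r)

transfer-correct : ∀ a t → a ≢ t → ∀ ρ → Σ Store λ ρ′ → Exec (loop a (inc t)) ρ ρ′ ×
  ρ′ t ≡ ρ a + ρ t × ρ′ a ≡ 0 × (∀ s → s ≢ a → s ≢ t → ρ′ s ≡ ρ s)
transfer-correct a t a≢t ρ = go (ρ a) ρ refl
  where
  go : ∀ n ρ → ρ a ≡ n → Σ Store λ ρ′ → Exec (loop a (inc t)) ρ ρ′ ×
    ρ′ t ≡ n + ρ t × ρ′ a ≡ 0 × (∀ s → s ≢ a → s ≢ t → ρ′ s ≡ ρ s)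
  go zero    ρ eq = ρ , exit eq , refl , eq , λ _ _ _ → refl
  go (suc n) ρ eq =
    let ρ₁ = ρ [ a ↦ n ]
        ρ₂ = ρ₁ [ t ↦ suc (ρ₁ t) ]
        ρ′ , run , ρ′t , ρ′a , same = go n ρ₂ (trans (update-other ρ₁ _ a≢t) (update-same ρ a n))
    in ρ′ , repeat eq inc run
     , trans ρ′t (trans (cong (n +_) (trans (update-same ρ₁ t _) (cong suc (update-other ρ n (≢-sym a≢t))))) (+-suc n (ρ t)))
     , ρ′a
     , λ s s≢a s≢t → trans (same s s≢a s≢t) (trans (update-other ρ₁ _ s≢t) (update-other ρ n s≢a))

distribute-correct : ∀ t a b → t ≢ a → t ≢ b → a ≢ b → ∀ ρ → Σ Store λ ρ′ → Exec (loop t (inc a ⨟ inc b)) ρ ρ′ ×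
  ρ′ a ≡ ρ t + ρ a × ρ′ b ≡ ρ t + ρ b × (∀ s → s ≢ t → s ≢ a → s ≢ b → ρ′ s ≡ ρ s)
distribute-correct t a b t≢a t≢b a≢b ρ = go (ρ t) ρ refl
  where
  go : ∀ n ρ → ρ t ≡ n → Σ Store λ ρ′ → Exec (loop t (inc a ⨟ inc b)) ρ ρ′ ×
    ρ′ a ≡ n + ρ a × ρ′ b ≡ n + ρ b × (∀ s → s ≢ t → s ≢ a → s ≢ b → ρ′ s ≡ ρ s)
  go zero    ρ eq = ρ , exit eq , refl , refl , λ _ _ _ _ → refl
  go (suc n) ρ eq =
    let ρ₁ = ρ [ t ↦ n ]
        ρ₂ = ρ₁ [ a ↦ suc (ρ₁ a) ]
        ρ₃ = ρ₂ [ b ↦ suc (ρ₂ b) ]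
        ρ′ , run , ρ′a , ρ′b , same =
          go n ρ₃ (trans (update-other ρ₂ _ t≢b) (trans (update-other ρ₁ _ t≢a) (update-same ρ t n)))
    in ρ′ , repeat eq (inc ⨟ inc) run
     , trans ρ′a (trans (cong (n +_) (trans (update-other ρ₂ _ a≢b) (trans (update-same ρ₁ a _)
         (cong suc (update-other ρ n (≢-sym t≢a)))))) (+-suc n (ρ a)))
     , trans ρ′b (trans (cong (n +_) (trans (update-same ρ₂ b _)
         (cong suc (trans (update-other ρ₁ _ (≢-sym a≢b)) (update-other ρ n (≢-sym t≢b)))))) (+-suc n (ρ b)))
     , λ s s≢t s≢a s≢b → trans (same s s≢t s≢a s≢b)
         (trans (update-other ρ₂ _ s≢b) (trans (update-other ρ₁ _ s≢a) (update-other ρ n s≢t)))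

-- A loop consumes its register, so the value is parked in the scratch register `t`, from which
-- source and target are filled together.
copy : ℕ → ℕ → ℕ → Cmd
copy a b t = clear b ⨟ clear t ⨟ loop a (inc t) ⨟ loop t (inc a ⨟ inc b)

copy-correct : ∀ a b t → a ≢ b → a ≢ t → b ≢ t → ∀ ρ → Σ Store λ ρ′ → Exec (copy a b t) ρ ρ′ ×
  ρ′ b ≡ ρ a × (∀ s → s ≢ b → s ≢ t → ρ′ s ≡ ρ s)
copy-correct a b t a≢b a≢t b≢t ρ =
  let ρ₁ , run₁ , ρ₁b , same₁ = clear-correct b ρ
      ρ₂ , run₂ , ρ₂t , same₂ = clear-correct t ρ₁
      ρ₃ , run₃ , ρ₃t , ρ₃a , same₃ = transfer-correct a t a≢t ρ₂
      ρ₄ , run₄ , ρ₄a , ρ₄b , same₄ = distribute-correct t a b (≢-sym a≢t) (≢-sym b≢t) a≢b ρ₃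
      ρ₂a = trans (same₂ a a≢t) (same₁ a a≢b)
      moved : ρ₃ t ≡ ρ a
      moved = trans ρ₃t (trans (cong₂ _+_ ρ₂a ρ₂t) (+-identityʳ (ρ a)))
      ρ₃b = trans (same₃ b (≢-sym a≢b) b≢t) (trans (same₂ b b≢t) ρ₁b)
      total : ∀ {x y} → x ≡ ρ a → y ≡ 0 → x + y ≡ ρ a
      total p q = trans (cong₂ _+_ p q) (+-identityʳ (ρ a))
      others : ∀ s → s ≢ b → s ≢ t → Dec (s ≡ a) → ρ₄ s ≡ ρ s
      others = λ where
        s s≢b s≢t (yes refl) → trans ρ₄a (total moved ρ₃a)
        s s≢b s≢t (no s≢a)   → trans (same₄ s s≢t s≢a s≢b)
          (trans (same₃ s s≢a s≢t) (trans (same₂ s s≢t) (same₁ s s≢b)))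
  in ρ₄ , run₁ ⨟ run₂ ⨟ run₃ ⨟ run₄ , trans ρ₄b (total moved ρ₃b) , λ s s≢b s≢t → others s s≢b s≢t (s ≟ a)

-- compile f ins o expects its arguments in registers ins < o, leaves the result in
-- register o and may overwrite all registers ≥ o.
mutual
  compile : ∀ {n} → Rec n → Vec ℕ n → ℕ → Cmd
  compile zer            ins        o = clear o
  compile succ           (r ∷ [])   o = copy r o (suc o) ⨟ inc o
  compile (proj i)       ins        o = copy (lookup ins i) o (suc o)
  compile (comp {k = k} f gs) ins   o =
    -- The intermediate values occupy registers directly above `o` and have to lie below the output
    -- register of `f`, so the result arises above them and is copied down.
    compile* gs ins (suc o) ⨟ compile f (slots (suc o) k) (suc o + k) ⨟ copy (suc o + k) o (suc (suc o + k))
  compile (prec g h)     (r ∷ ins)  o =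
    -- Register `o` accumulates the value, `1 + o` counts the finished iterations, `2 + o` the
    -- remaining ones, and everything from `3 + o` on is scratch.
    compile g ins o ⨟ clear (1 + o) ⨟ copy r (2 + o) (3 + o) ⨟ loop (2 + o) (precBody h ins o)
  compile (mu f)         ins        o =
    -- Register `o` holds the candidate. The loop spoils the value in `suc o` by its decrement, but
    -- that value is only tested for zero and is recomputed by the body.
    clear o ⨟ compile f (o ∷ ins) (suc o) ⨟ loop (suc o) (inc o ⨟ compile f (o ∷ ins) (suc o))

  compile* : ∀ {n k} → Vec (Rec n) k → Vec ℕ n → ℕ → Cmd
  compile* []       ins o = nop
  compile* (g ∷ gs) ins o = compile g ins o ⨟ compile* gs ins (suc o)

  precBody : ∀ {n} → Rec (suc (suc n)) → Vec ℕ n → ℕ → Cmd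
  precBody h ins o = compile h ((1 + o) ∷ o ∷ ins) (3 + o) ⨟ copy (3 + o) o (4 + o) ⨟ inc (1 + o)

  slots : ℕ → ∀ k → Vec ℕ k
  slots o zero    = []
  slots o (suc k) = o ∷ slots (suc o) k

Reads : ∀ {n} → Store → ℕ → Vec ℕ n → Vec ℕ n → Set
Reads ρ o = Pointwise (λ r x → r < o × ρ r ≡ x)

Frame : ℕ → Store → Store → Set
Frame o ρ ρ′ = ∀ r → r < o → ρ′ r ≡ ρ r

frame-trans : ∀ {o o′ ρ ρ′ ρ″} → o ≤ o′ → Frame o ρ ρ′ → Frame o′ ρ′ ρ″ → Frame o ρ ρ″
frame-trans o≤o′ fr fr′ r r<o = trans (fr′ r (<-≤-trans r<o o≤o′)) (fr r r<o)

reads-frame : ∀ {n ρ ρ′ o o′} {ins xs : Vec ℕ n} → o ≤ o′ → Frame o ρ ρ′ → Reads ρ o ins xs → Reads ρ′ o′ ins xs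
reads-frame o≤o′ fr = PW.map λ { (r<o , eq) → <-≤-trans r<o o≤o′ , trans (fr _ r<o) eq }

RunsTo : Cmd → ℕ → Store → ℕ → Set
RunsTo c o ρ y = Σ Store λ ρ′ → Exec c ρ ρ′ × ρ′ o ≡ y × Frame o ρ ρ′

Correct : ∀ {n} → Rec n → Vec ℕ n → ℕ → Set
Correct f xs y = ∀ {ins o ρ} → Reads ρ o ins xs → RunsTo (compile f ins o) o ρ y

Holds : ∀ {k} → Store → ℕ → Vec ℕ k → Set
Holds {k} ρ o ys = Reads ρ (o + k) (slots o k) ys

Correct* : ∀ {n k} → Vec (Rec n) k → Vec ℕ n → Vec ℕ k → Set
Correct* gs xs ys = ∀ {ins o ρ} → Reads ρ o ins xs →
  Σ Store λ ρ′ → Exec (compile* gs ins o) ρ ρ′ × Holds ρ′ o ys × Frame o ρ ρ′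

outside : ∀ {r o} k → r < o → r ≢ k + o
outside k r<o = <⇒≢ (<-≤-trans r<o (m≤n+m _ k))

copy-runs : ∀ {a o ρ} → a < o → RunsTo (copy a o (suc o)) o ρ (ρ a)
copy-runs {a} {o} {ρ} a<o =
  let ρ′ , run , res , same = copy-correct a o (suc o) (outside 0 a<o) (outside 1 a<o) (<⇒≢ (n<1+n o)) ρ
  in ρ′ , run , res , λ r r<o → same r (outside 0 r<o) (outside 1 r<o)

-- A derivation for `prec` adds the last iteration outermost, whereas `Exec` peels off the first
-- one. Collecting iterations in a `Star` allows them to be appended at the end.
Iteration : ℕ → Cmd → Store → Store → Set
Iteration r c ρ ρ′ = Σ ℕ λ n → ρ r ≡ suc n × Exec c (ρ [ r ↦ n ]) ρ′

iterations-exec : ∀ {r c ρ ρ′} → Star (Iteration r c) ρ ρ′ → ρ′ r ≡ 0 → Exec (loop r c) ρ ρ′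
iterations-exec ε                   eq = exit eq
iterations-exec ((n , p , run) ◅ s) eq = repeat p run (iterations-exec s eq)

record PrecState {n} (o : ℕ) (ins xs : Vec ℕ n) (ρ : Store) (acc count left : ℕ) : Set where
  constructor precState
  field
    args : Reads ρ o ins xs
    accE : ρ o ≡ acc
    cntE : ρ (1 + o) ≡ count
    lftE : ρ (2 + o) ≡ left

open PrecState

-- The derivation for n unfolds into a start value and n iterations.
PrecRuns : ∀ {n} → Rec n → Rec (suc (suc n)) → Vec ℕ n → ℕ → ℕ → Set
PrecRuns g h xs k y = Σ ℕ λ r₀ → Correct g xs r₀ ×
  (∀ {ins o ρ} m → PrecState o ins xs ρ r₀ 0 (k + m) →
   Σ Store λ ρ′ → Star (Iteration (2 + o) (precBody h ins o)) ρ ρ′ × PrecState o ins xs ρ′ y k m × Frame o ρ ρ′)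

prec-iteration : ∀ {n} {h : Rec (suc (suc n))} {xs k r y} → Correct h (k ∷ r ∷ xs) y →
  ∀ {ins o ρ m} → PrecState o ins xs ρ r k (suc m) →
  Σ Store λ ρ′ → Iteration (2 + o) (precBody h ins o) ρ ρ′ × PrecState o ins xs ρ′ y (suc k) m × Frame o ρ ρ′
prec-iteration ch {ins} {o} {ρ} {m} st =
  let ρ₁ = ρ [ 2 + o ↦ m ]
      fr₁ : Frame o ρ ρ₁
      fr₁ r r<o = update-other ρ m (outside 2 r<o)
      o₁ = m<n⇒m<1+n (m<n⇒m<1+n (n<1+n o))
      o₂ = m<n⇒m<1+n (n<1+n (1 + o))
      ρ₂ , run₂ , res₂ , fr₂ = ch ((o₂ , trans (update-other ρ m (<⇒≢ (n<1+n (1 + o)))) (cntE st))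
        ∷ (o₁ , trans (update-other ρ m (<⇒≢ (m<n⇒m<1+n (n<1+n o)))) (accE st))
        ∷ reads-frame (m≤n+m o 3) fr₁ (args st))
      ρ₃ , run₃ , res₃ , same₃ = copy-correct (3 + o) o (4 + o) (≢-sym (<⇒≢ o₁)) (<⇒≢ (n<1+n (3 + o)))
        (<⇒≢ (m<n⇒m<1+n o₁)) ρ₂
      ρ₄ = ρ₃ [ 1 + o ↦ suc (ρ₃ (1 + o)) ]
      fr : Frame o ρ ρ₄
      fr r r<o = trans (update-other ρ₃ _ (outside 1 r<o)) (trans (same₃ r (outside 0 r<o) (outside 4 r<o))
        (trans (fr₂ r (<-≤-trans r<o (m≤n+m o 3))) (fr₁ r r<o)))
      mid : ∀ k → (k + o) ≢ o → (k + o) < 3 + o → ρ₃ (k + o) ≡ ρ₁ (k + o)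
      mid k ne lt = trans (same₃ (k + o) ne (<⇒≢ (m<n⇒m<1+n lt))) (fr₂ (k + o) lt)
  in ρ₄ , (m , lftE st , run₂ ⨟ run₃ ⨟ inc)
   , precState (reads-frame ≤-refl fr (args st))
       (trans (update-other ρ₃ _ (<⇒≢ (n<1+n o))) (trans res₃ res₂))
       (trans (update-same ρ₃ (1 + o) _) (cong suc (trans (mid 1 (≢-sym (<⇒≢ (n<1+n o))) o₂)
         (trans (update-other ρ m (<⇒≢ (n<1+n (1 + o)))) (cntE st)))))
       (trans (update-other ρ₃ _ (≢-sym (<⇒≢ (n<1+n (1 + o))))) (trans (mid 2 (≢-sym (<⇒≢ (m<n⇒m<1+n (n<1+n o)))) (n<1+n (2 + o)))
         (update-same ρ (2 + o) m)))
   , fr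

precRuns-correct : ∀ {n} {g : Rec n} {h xs k y} → PrecRuns g h xs k y → Correct (prec g h) (k ∷ xs) y
precRuns-correct {k = k} (r₀ , cg , loops) {r ∷ ins} {o} {ρ} ((r<o , ρr) ∷ rs) =
  let ρ₁ , run₁ , res₁ , fr₁ = cg rs
      ρ₂ , run₂ , ρ₂c , same₂ = clear-correct (1 + o) ρ₁
      ρ₃ , run₃ , ρ₃l , same₃ = copy-correct r (2 + o) (3 + o) (outside 2 r<o) (outside 3 r<o) (<⇒≢ (n<1+n (2 + o))) ρ₂
      fr₂ : Frame o ρ₁ ρ₂
      fr₂ s s<o = same₂ s (outside 1 s<o)
      fr₃ : Frame o ρ₂ ρ₃
      fr₃ s s<o = same₃ s (outside 2 s<o) (outside 3 s<o)
      fr : Frame o ρ ρ₃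
      fr = frame-trans ≤-refl fr₁ (frame-trans ≤-refl fr₂ fr₃)
      ρ₄ , runs , st , fr₄ = loops 0 (precState (reads-frame ≤-refl fr rs)
        (trans (same₃ o (<⇒≢ (m<n⇒m<1+n (n<1+n o))) (<⇒≢ (m<n⇒m<1+n (m<n⇒m<1+n (n<1+n o)))))
          (trans (same₂ o (<⇒≢ (n<1+n o))) res₁))
        (trans (same₃ (1 + o) (<⇒≢ (n<1+n (1 + o))) (<⇒≢ (m<n⇒m<1+n (n<1+n (1 + o))))) ρ₂c)
        (trans ρ₃l (trans (fr₂ r r<o) (trans (fr₁ r r<o) (trans ρr (sym (+-identityʳ k)))))))
  in ρ₄ , run₁ ⨟ run₂ ⨟ run₃ ⨟ iterations-exec runs (lftE st) , accE st , frame-trans ≤-refl fr fr₄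


module _ {n} {f : Rec (suc n)} {xs : Vec ℕ n} {y} (root : Correct f (y ∷ xs) 0)
         (below : ∀ z → z < y → Σ ℕ λ v → Correct f (z ∷ xs) (suc v)) where

  -- The value of f at distance d below its first root.
  AtDistance : ℕ → ℕ → Set
  AtDistance zero    v = v ≡ 0
  AtDistance (suc d) v = Σ ℕ λ u → v ≡ suc u

  mu-eval : ∀ d z → z + d ≡ y → ∀ {ins o ρ} → Reads ρ o ins xs → ρ o ≡ z →
    Σ Store λ ρ′ → Exec (compile f (o ∷ ins) (suc o)) ρ ρ′ × AtDistance d (ρ′ (suc o)) × Frame (suc o) ρ ρ′
  mu-eval zero z z+d {o = o} rs ρo =
    let ρ′ , run , res , fr = root ((n<1+n o , trans ρo (trans (sym (+-identityʳ z)) z+d)) ∷ reads-frame (n≤1+n o) (λ _ _ → refl) rs)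
    in ρ′ , run , res , fr
  mu-eval (suc d) z z+d {o = o} rs ρo =
    let v , correct = below z (subst (z <_) z+d (m<m+n z (s≤s z≤n)))
        ρ′ , run , res , fr = correct ((n<1+n o , ρo) ∷ reads-frame (n≤1+n o) (λ _ _ → refl) rs)
    in ρ′ , run , (v , res) , fr

  -- Induction on the distance `d` to the root: as long as it is positive the value in `suc o` is
  -- positive too, so the loop goes on and the body advances the candidate by one.
  mu-loop : ∀ d z → z + d ≡ y → ∀ {ins o ρ} → Reads ρ o ins xs → ρ o ≡ z → AtDistance d (ρ (suc o)) →
    RunsTo (loop (suc o) (inc o ⨟ compile f (o ∷ ins) (suc o))) o ρ y
  mu-loop zero z z+d {ρ = ρ} rs ρo at = ρ , exit at , trans ρo (trans (sym (+-identityʳ z)) z+d) , λ _ _ → refl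
  mu-loop (suc d) z z+d {o = o} {ρ} rs ρo (u , at) =
    let ρ₁ = ρ [ suc o ↦ u ]
        ρ₂ = ρ₁ [ o ↦ suc (ρ₁ o) ]
        fr₂ : Frame o ρ ρ₂
        fr₂ r r<o = trans (update-other ρ₁ _ (outside 0 r<o)) (update-other ρ u (outside 1 r<o))
        ρ₂o = trans (update-same ρ₁ o _) (cong suc (trans (update-other ρ u (<⇒≢ (n<1+n o))) ρo))
        z+d′ = trans (sym (+-suc z d)) z+d
        ρ₃ , run₃ , at₃ , fr₃ = mu-eval d (suc z) z+d′ (reads-frame ≤-refl fr₂ rs) ρ₂o
        fr = frame-trans (n≤1+n o) fr₂ fr₃
        ρ₄ , run₄ , res₄ , fr₄ = mu-loop d (suc z) z+d′ (reads-frame ≤-refl fr rs) (trans (fr₃ o (n<1+n o)) ρ₂o) at₃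
    in ρ₄ , repeat at (inc ⨟ run₃) run₄ , res₄ , frame-trans ≤-refl fr fr₄

  mu-correct : Correct (mu f) xs y
  mu-correct {o = o} {ρ} rs =
    let ρ₁ , run₁ , ρ₁o , same₁ = clear-correct o ρ
        fr₁ : Frame o ρ ρ₁
        fr₁ r r<o = same₁ r (outside 0 r<o)
        rs₁ = reads-frame ≤-refl fr₁ rs
        ρ₂ , run₂ , at₂ , fr₂ = mu-eval y 0 refl rs₁ ρ₁o
        fr = frame-trans (n≤1+n o) fr₁ fr₂
        ρ₃ , run₃ , res₃ , fr₃ = mu-loop y 0 refl (reads-frame ≤-refl fr rs) (trans (fr₂ o (n<1+n o)) ρ₁o) at₂
    in ρ₃ , run₁ ⨟ run₂ ⨟ run₃ , res₃ , frame-trans ≤-refl fr fr₃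

mutual
  compile-correct : ∀ {n} {f : Rec n} {xs y} → f [ xs ]⇓ y → Correct f xs y
  compile-correct ev-zer {o = o} {ρ} rs =
    let ρ′ , run , res , same = clear-correct o ρ in ρ′ , run , res , λ r r<o → same r (outside 0 r<o)
  compile-correct ev-succ {r ∷ []} {o} {ρ} ((r<o , eq) ∷ []) =
    let ρ′ , run , res , fr = copy-runs {ρ = ρ} r<o
    in ρ′ [ o ↦ suc (ρ′ o) ] , run ⨟ inc , trans (update-same ρ′ o _) (cong suc (trans res eq))
     , λ s s<o → trans (update-other ρ′ _ (outside 0 s<o)) (fr s s<o)
  compile-correct (ev-proj i) {ρ = ρ} rs =
    let r<o , eq = PW.lookup rs i
        ρ′ , run , res , fr = copy-runs {ρ = ρ} r<o
    in ρ′ , run , trans res eq , fr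
  compile-correct (ev-comp {k = k} es e) {o = o} rs =
    let ρ₁ , run₁ , holds , fr₁ = compile*-correct es (reads-frame (n≤1+n o) (λ _ _ → refl) rs)
        ρ₂ , run₂ , res₂ , fr₂ = compile-correct e holds
        a = suc o + k
        o<a = s≤s (m≤m+n o k)
        ρ₃ , run₃ , res₃ , same₃ = copy-correct a o (suc a) (≢-sym (<⇒≢ o<a)) (<⇒≢ (n<1+n a)) (<⇒≢ (m<n⇒m<1+n o<a)) ρ₂
    in ρ₃ , run₁ ⨟ run₂ ⨟ run₃ , trans res₃ res₂
     , frame-trans ≤-refl (frame-trans (<⇒≤ o<a) (λ r r<o → fr₁ r (m<n⇒m<1+n r<o)) fr₂)
         (λ r r<o → same₃ r (outside 0 r<o) (<⇒≢ (<-trans r<o (m<n⇒m<1+n o<a))))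
  compile-correct (ev-prec0 e) rs = precRuns-correct (_ , compile-correct e , λ m st → _ , ε , st , λ _ _ → refl) rs
  compile-correct (ev-precS d e) rs = precRuns-correct (prec-step (prec-unfold d) (compile-correct e)) rs
  compile-correct (ev-mu e es) rs =
    mu-correct (compile-correct e) (λ z z<y → proj₁ (es z z<y) , compile-correct (proj₂ (es z z<y))) rs

  compile*-correct : ∀ {n k} {gs : Vec (Rec n) k} {xs ys} → gs [ xs ]⇓* ys → Correct* gs xs ys
  compile*-correct [] {ρ = ρ} rs = ρ , nop , [] , λ _ _ → refl
  compile*-correct (_∷_ {k = k} {ys = ys} e es) {o = o} rs =
    let ρ₁ , run₁ , res₁ , fr₁ = compile-correct e rs
        ρ₂ , run₂ , holds , fr₂ = compile*-correct es (reads-frame (n≤1+n o) fr₁ rs)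
    in ρ₂ , run₁ ⨟ run₂
     , (m<m+n o (s≤s z≤n) , trans (fr₂ o (n<1+n o)) res₁) ∷ subst (λ b → Reads ρ₂ b (slots (suc o) k) ys) (sym (+-suc o k)) holds
     , frame-trans (n≤1+n o) fr₁ fr₂

  -- `Correct` for the smaller counter would describe a loop that has already run out. To add an
  -- iteration, the recursion on the derivation has to return the open form with `m` iterations
  -- left.
  prec-unfold : ∀ {n} {g : Rec n} {h k xs y} → prec g h [ k ∷ xs ]⇓ y → PrecRuns g h xs k y
  prec-unfold (ev-prec0 e)   = _ , compile-correct e , λ m st → _ , ε , st , λ _ _ → refl
  prec-unfold (ev-precS d e) = prec-step (prec-unfold d) (compile-correct e)

  prec-step : ∀ {n} {g : Rec n} {h xs k r y} → PrecRuns g h xs k r → Correct h (k ∷ r ∷ xs) y → PrecRuns g h xs (suc k) y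
  prec-step {k = k} (r₀ , cg , loops) ch = r₀ , cg , λ {ins} {o} {ρ} m st →
    let ρ₁ , its , st₁ , fr₁ = loops (suc m) (subst (PrecState o ins _ ρ r₀ 0) (sym (+-suc k m)) st)
        ρ₂ , it , st₂ , fr₂ = prec-iteration ch st₁
    in ρ₂ , its ◅◅ (it ◅ ε) , st₂ , frame-trans ≤-refl fr₁ fr₂

bound : Cmd → ℕ
bound (inc r)    = suc r
bound nop        = 0
bound (c ⨟ d)    = bound c ⊔ bound d
bound (loop r c) = suc r ⊔ bound c

-- Queue machines executing register programs

record Finite (A : Set) : Set where
  field
    size    : ℕ
    to      : A → Fin size
    from    : Fin size → A
    from-to : ∀ a → from (to a) ≡ a

open Finite

fin-finite : ∀ n → Finite (Fin n)
fin-finite n = record { size = n ; to = λ i → i ; from = λ i → i ; from-to = λ _ → refl }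

⊥-finite : Finite ⊥
⊥-finite = record { size = 0 ; to = λ () ; from = λ () ; from-to = λ () }

⊤-finite : Finite ⊤
⊤-finite = record { size = 1 ; to = λ _ → zero ; from = λ _ → tt ; from-to = λ _ → refl }

bool-finite : Finite Bool
bool-finite = record
  { size = 2 ; to = λ { false → zero ; true → suc zero } ; from = λ { zero → false ; (suc _) → true }
  ; from-to = λ { false → refl ; true → refl } }

maybe-finite : ∀ {A} → Finite A → Finite (Maybe A)
maybe-finite F = record
  { size = suc (size F) ; to = λ { nothing → zero ; (just a) → suc (to F a) }
  ; from = λ { zero → nothing ; (suc i) → just (from F i) }
  ; from-to = λ { nothing → refl ; (just a) → cong just (from-to F a) } }

sum-finite : ∀ {A B} → Finite A → Finite B → Finite (A ⊎ B)
sum-finite {A} {B} F G = record { size = size F + size G ; to = enc ; from = dec ∘ Fin.splitAt (size F) ; from-to = dec-enc }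
  where
  enc : A ⊎ B → Fin (size F + size G)
  enc (inj₁ a) = to F a Fin.↑ˡ size G
  enc (inj₂ b) = size F Fin.↑ʳ to G b
  dec : Fin (size F) ⊎ Fin (size G) → A ⊎ B
  dec (inj₁ i) = inj₁ (from F i)
  dec (inj₂ j) = inj₂ (from G j)
  dec-enc : ∀ x → dec (Fin.splitAt (size F) (enc x)) ≡ x
  dec-enc (inj₁ a) = trans (cong dec (Fin.splitAt-↑ˡ (size F) (to F a) (size G))) (cong inj₁ (from-to F a))
  dec-enc (inj₂ b) = trans (cong dec (Fin.splitAt-↑ʳ (size F) (size G) (to G b))) (cong inj₂ (from-to G b))

product-finite : ∀ {A B} → Finite A → Finite B → Finite (A × B)
product-finite F G = record
  { size = size F * size G ; to = λ (a , b) → Fin.combine (to F a) (to G b)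
  ; from = λ i → let (j , k) = Fin.remQuot (size G) i in from F j , from G k
  ; from-to = λ (a , b) → trans (cong (λ (j , k) → from F j , from G k) (Fin.remQuot-combine (to F a) (to G b)))
                                (cong₂ _,_ (from-to F a) (from-to G b)) }

data Letter : Set where
  one sep : Letter

letter-finite : Finite Letter
letter-finite = record
  { size = 2 ; to = λ { one → zero ; sep → suc zero } ; from = λ { zero → one ; (suc _) → sep }
  ; from-to = λ { one → refl ; sep → refl } }

data Action (Q : Set) : Set where
  halt : Action Q
  recv : (Letter → Q) → Action Q
  send : Letter → Q → Action Q

-- pot bounds twice the number of letters that can be sent before the next receive.
record QueueMachine : Set₁ where
  field
    Q        : Set
    finite   : Finite Q
    act      : Q → Action Q
    pot      : Q → ℕ
    pot-send : ∀ {q e q′} → act q ≡ send e q′ → 2 + pot q′ ≤ pot q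

module Runs (M : QueueMachine) where
  open QueueMachine M

  -- the oldest letter of the queue comes first
  QConf : Set
  QConf = Q × List Letter

  data _⟶_ : QConf → QConf → Set where
    recvS : ∀ {q f d w} → act q ≡ recv f → (q , d ∷ w) ⟶ (f d , w)
    sendS : ∀ {q e q′ w} → act q ≡ send e q′ → (q , w) ⟶ (q′ , w ++ [ e ])

  _⟶*_ : QConf → QConf → Set
  _⟶*_ = Star _⟶_

  deterministic : ∀ {c c₁ c₂} → c ⟶ c₁ → c ⟶ c₂ → c₁ ≡ c₂
  deterministic (recvS a) (recvS b) with refl ← trans (sym a) b = refl
  deterministic (recvS a) (sendS b) with () ← trans (sym a) b
  deterministic (sendS a) (recvS b) with () ← trans (sym a) b
  deterministic (sendS a) (sendS b) with refl ← trans (sym a) b = refl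

  data Long : ℕ → QConf → Set where
    stop : ∀ {c} → Long 0 c
    step : ∀ {n c c′} → c ⟶ c′ → Long n c′ → Long (suc n) c

  -- Divergence is expressed by finite runs of every length. As the machine is deterministic, these
  -- runs extend one another, which is what lets `live-step` pass to the successor.
  Live : QConf → Set
  Live c = ∀ n → Long n c

  long-weaken : ∀ {n c} → Long (suc n) c → Long n c
  long-weaken {zero}  _          = stop
  long-weaken {suc n} (step s l) = step s (long-weaken l)

  long-prefix : ∀ {n c c′} → c ⟶* c′ → Long n c′ → Long n c
  long-prefix ε        l = l
  long-prefix (s ◅ ss) l = long-weaken (step s (long-prefix ss l))

  live-step : ∀ {c c′} → Live c → c ⟶ c′ → Live c′
  live-step live s n with live (suc n)
  ... | step s′ l with refl ← deterministic s s′ = l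

  live-¬halt : ∀ {q w} → Live (q , w) → act q ≢ halt
  live-¬halt live eq with live 1
  ... | step (recvS a) _ with () ← trans (sym eq) a
  ... | step (sendS a) _ with () ← trans (sym eq) a

-- Control positions of register programs

data Op : Set where
  incr    : ℕ → Op
  decJump : ℕ → Op

Pos : Cmd → Set
Pos (inc r)    = ⊤
Pos nop        = ⊥
Pos (c ⨟ d)    = Pos c ⊎ Pos d
Pos (loop r c) = Maybe (Pos c)

pos-finite : ∀ c → Finite (Pos c)
pos-finite (inc r)    = ⊤-finite
pos-finite nop        = ⊥-finite
pos-finite (c ⨟ d)    = sum-finite (pos-finite c) (pos-finite d)
pos-finite (loop r c) = maybe-finite (pos-finite c)

opAt : ∀ c → Pos c → Op
opAt (inc r)    p        = incr r
opAt (c ⨟ d)    (inj₁ p) = opAt c p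
opAt (c ⨟ d)    (inj₂ p) = opAt d p
opAt (loop r c) nothing  = decJump r
opAt (loop r c) (just p) = opAt c p

module _ {S : Set} where

  -- e embeds the positions of the command and x is where control goes afterwards.
  enter : ∀ c → (Pos c → S) → S → S
  enter (inc r)    e x = e tt
  enter nop        e x = x
  enter (c ⨟ d)    e x = enter c (e ∘ inj₁) (enter d (e ∘ inj₂) x)
  enter (loop r c) e x = e nothing

  -- The flag tells whether a decJump has decremented.
  successor : ∀ c → (Pos c → S) → S → Pos c → Bool → S
  successor (inc r)    e x p        b     = x
  successor (c ⨟ d)    e x (inj₁ p) b     = successor c (e ∘ inj₁) (enter d (e ∘ inj₂) x) p b
  successor (c ⨟ d)    e x (inj₂ p) b     = successor d (e ∘ inj₂) x p b
  successor (loop r c) e x nothing  true  = enter c (e ∘ just) (e nothing)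
  successor (loop r c) e x nothing  false = x
  successor (loop r c) e x (just p) b     = successor c (e ∘ just) (e nothing) p b

-- Registers k, …, 0 are kept in this order, in unary, each followed by sep; an
-- operation is one rotation of the queue.  The second component of a state is the
-- register whose block is at the front.
module Compiled (prog : Cmd) (k : ℕ) where

  Point : Set
  Point = Maybe (Pos prog)

  data Mode : Set where
    reading writeOne writeSep writeBoth : Mode

  mode-finite : Finite Mode
  mode-finite = record
    { size = 4
    ; to = λ { reading → zero ; writeOne → suc zero ; writeSep → suc (suc zero) ; writeBoth → suc (suc (suc zero)) }
    ; from = λ { zero → reading ; (suc zero) → writeOne ; (suc (suc zero)) → writeSep ; (suc (suc (suc _))) → writeBoth }
    ; from-to = λ { reading → refl ; writeOne → refl ; writeSep → refl ; writeBoth → refl } }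

  State : Set
  State = Point × Fin (suc k) × Bool × Mode

  next : Pos prog → Bool → Point
  next = successor prog just nothing

  start : Point → State
  start p = p , fromℕ k , false , reading

  -- The flag is set when a letter is removed, so `not b` limits a rotation to one removal. At the
  -- end of the rotation the same flag decides the jump.
  drops : Op → ℕ → Bool → Bool
  drops (incr r)    i b = false
  drops (decJump r) i b = not b ∧ does (i ≟ r)

  grows : Op → ℕ → Bool
  grows (incr r)    i = does (i ≟ r)
  grows (decJump r) i = false

  afterSep : Point → Fin (suc k) → Bool → State
  -- A default: runs from `start` reach the point `nothing` only in mode `reading`, where the
  -- machine halts.
  afterSep nothing  i       b = start nothing
  afterSep (just p) zero    b = start (next p b)
  afterSep (just p) (suc i) b = just p , inject₁ i , b , reading

  afterRead : Pos prog → Fin (suc k) → Bool → Letter → State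
  afterRead p i b one = if drops (opAt prog p) (toℕ i) b then (just p , i , true , reading) else (just p , i , b , writeOne)
  afterRead p i b sep = just p , i , b , (if grows (opAt prog p) (toℕ i) then writeBoth else writeSep)

  action : State → Action State
  action (just p , i , b , reading) = recv (afterRead p i b)
  action (nothing , i , b , reading) = halt
  action (p , i , b , writeOne)  = send one (p , i , b , reading)
  action (p , i , b , writeSep)  = send sep (afterSep p i b)
  action (p , i , b , writeBoth) = send one (p , i , b , writeSep)

  -- Two units for each letter still to be written, because the sender will need two instructions
  -- for it; after a separator the machine is reading again.
  potential : State → ℕ
  potential (_ , _ , _ , reading)   = 0
  potential (_ , _ , _ , writeOne)  = 2
  potential (_ , _ , _ , writeSep)  = 2
  potential (_ , _ , _ , writeBoth) = 4

  potential-send : ∀ {q e q′} → action q ≡ send e q′ → 2 + potential q′ ≤ potential q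
  potential-send {nothing , i , b , writeOne}      refl = ≤-refl
  potential-send {just p  , i , b , writeOne}      refl = ≤-refl
  potential-send {nothing , i , b , writeBoth}     refl = ≤-refl
  potential-send {just p  , i , b , writeBoth}     refl = ≤-refl
  potential-send {nothing , i , b , writeSep}      refl = ≤-refl
  potential-send {just p  , zero , b , writeSep}   refl = ≤-refl
  potential-send {just p  , suc i , b , writeSep}  refl = ≤-refl
  potential-send {nothing , i , b , reading}       ()
  potential-send {just p , i , b , reading}        ()

  machine : QueueMachine
  machine = record
    { Q = State
    ; finite = product-finite (maybe-finite (pos-finite prog)) (product-finite (fin-finite (suc k)) (product-finite bool-finite mode-finite))
    ; act = action ; pot = potential ; pot-send = λ {q} → potential-send {q} }

  open Runs machine public

  from-state : ∀ {q q′ w c} → q ≡ q′ → (q′ , w) ⟶* c → (q , w) ⟶* c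
  from-state refl run = run

  from-queue : ∀ {q w w′ c} → w ≡ w′ → (q , w′) ⟶* c → (q , w) ⟶* c
  from-queue refl run = run

  to-queue : ∀ {c q w w′} → c ⟶* (q , w) → w ≡ w′ → c ⟶* (q , w′)
  to-queue run refl = run

  blocks : Store → ℕ → List Letter
  blocks ρ zero    = []
  blocks ρ (suc n) = replicate (ρ n) one ++ sep ∷ blocks ρ n

  blocks-cong : ∀ {ρ ρ′} n → (∀ r → r < n → ρ r ≡ ρ′ r) → blocks ρ n ≡ blocks ρ′ n
  blocks-cong zero    eq = refl
  blocks-cong (suc n) eq = cong₂ (λ m bs → replicate m one ++ sep ∷ bs) (eq n ≤-refl) (blocks-cong n (λ r r<n → eq r (m<n⇒m<1+n r<n)))

  config : Point → Store → QConf
  config p ρ = start p , blocks ρ (suc k)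

  -- The effect of a rotation on the length of a block. It separates the letter-by-letter runs from
  -- the arithmetic of the registers.
  afterBlock : Op → ℕ → Bool → ℕ → Bool × ℕ
  afterBlock op i b zero    = b , (if grows op i then 1 else 0)
  afterBlock op i b (suc n) = if drops op i b then (true , n) else (b , (if grows op i then 2 + n else 1 + n))

  afterBlocks : Op → Bool → Store → ℕ → Bool × List Letter
  afterBlocks op b ρ zero    = b , []
  afterBlocks op b ρ (suc i) =
    let b₁ , n₁ = afterBlock op i b (ρ i)
        b₂ , w₂ = afterBlocks op b₁ ρ i
    in b₂ , replicate n₁ one ++ sep ∷ w₂

  replicate-snoc : ∀ n (w : List Letter) → w ++ replicate (suc n) one ≡ (w ++ [ one ]) ++ replicate n one
  replicate-snoc n w = sym (++-assoc w [ one ] (replicate n one))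

  replicate-push : ∀ n → replicate n one ++ [ one ] ≡ replicate (suc n) one
  replicate-push zero    = refl
  replicate-push (suc n) = cong (one ∷_) (replicate-push n)

  module _ (p : Pos prog) where
    private op = opAt prog p

    read-sep : ∀ i b rest → ((just p , i , b , reading) , sep ∷ rest) ⟶*
      (afterSep (just p) i b , rest ++ replicate (if grows op (toℕ i) then 1 else 0) one ++ [ sep ])
    read-sep i b rest with grows op (toℕ i) in eq
    ... | true  = recvS refl ◅ from-state (cong (λ g → just p , i , b , (if g then writeBoth else writeSep)) eq)
                    (sendS refl ◅ sendS refl ◅ to-queue ε (++-assoc rest [ one ] [ sep ]))
    ... | false = recvS refl ◅ from-state (cong (λ g → just p , i , b , (if g then writeBoth else writeSep)) eq)
                    (sendS refl ◅ ε)

    read-ones : ∀ i b → drops op (toℕ i) b ≡ false → ∀ n rest →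
      ((just p , i , b , reading) , replicate n one ++ rest) ⟶* ((just p , i , b , reading) , rest ++ replicate n one)
    read-ones i b keep zero    rest = to-queue ε (sym (++-identityʳ rest))
    read-ones i b keep (suc n) rest =
      recvS refl ◅ from-state (cong (λ d → if d then (just p , i , true , reading) else (just p , i , b , writeOne)) keep)
        (sendS refl ◅ from-queue (++-assoc (replicate n one) rest [ one ])
          (to-queue (read-ones i b keep n (rest ++ [ one ])) (sym (replicate-snoc n rest))))

    grow : ∀ g n → replicate n one ++ replicate (if g then 1 else 0) one ++ [ sep ] ≡
                   replicate (if g then suc n else n) one ++ [ sep ]
    grow true  n = trans (sym (++-assoc (replicate n one) [ one ] [ sep ])) (cong (_++ [ sep ]) (replicate-push n))
    grow false n = refl

    keep-block : ∀ i b → drops op (toℕ i) b ≡ false → ∀ n rest →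
      ((just p , i , b , reading) , replicate n one ++ sep ∷ rest) ⟶*
      (afterSep (just p) i b , rest ++ replicate (if grows op (toℕ i) then suc n else n) one ++ [ sep ])
    keep-block i b keep n rest = read-ones i b keep n (sep ∷ rest) ◅◅
      to-queue (read-sep i b (rest ++ replicate n one))
        (trans (++-assoc rest _ _) (cong (rest ++_) (grow (grows op (toℕ i)) n)))

    drops-true : ∀ op i → drops op i true ≡ false
    drops-true (incr _)    i = refl
    drops-true (decJump _) i = refl

    drops⇒¬grows : ∀ op i b → drops op i b ≡ true → grows op i ≡ false
    drops⇒¬grows (decJump _) i b _ = refl

    block-step : ∀ i b n rest → let b′ , n′ = afterBlock op (toℕ i) b n in
      ((just p , i , b , reading) , replicate n one ++ sep ∷ rest) ⟶*
      (afterSep (just p) i b′ , rest ++ replicate n′ one ++ [ sep ])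
    block-step i b zero    rest = read-sep i b rest
    block-step i b (suc n) rest with drops op (toℕ i) b in eq
    ... | false = keep-block i b eq (suc n) rest
    ... | true  = recvS refl ◅
      from-state (cong (λ d → if d then (just p , i , true , reading) else (just p , i , b , writeOne)) eq)
        (to-queue (keep-block i true (drops-true op (toℕ i)) n rest)
          (cong (λ g → rest ++ replicate (if g then suc n else n) one ++ [ sep ]) (drops⇒¬grows op (toℕ i) b eq)))

    -- `out` collects the rewritten blocks behind the unread ones. After the block of register 0
    -- only rewritten blocks are left, in their original order.
    rotation : ∀ n i → toℕ i ≡ n → ∀ b ρ out → let b′ , w = afterBlocks op b ρ (suc n) in
      ((just p , i , b , reading) , blocks ρ (suc n) ++ out) ⟶* (start (next p b′) , out ++ w)
    rotation n i refl b ρ out =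
      from-queue (++-assoc (replicate (ρ n) one) _ out)
        (block-step i b (ρ n) (blocks ρ n ++ out) ◅◅ rest n i refl)
      where
      b₁ = proj₁ (afterBlock op n b (ρ n))
      n₁ = proj₂ (afterBlock op n b (ρ n))
      block = replicate n₁ one ++ [ sep ]
      rest : ∀ m j → toℕ j ≡ m → (afterSep (just p) j b₁ , (blocks ρ m ++ out) ++ block) ⟶*
             (start (next p (proj₁ (afterBlocks op b₁ ρ m))) , out ++ replicate n₁ one ++ sep ∷ proj₂ (afterBlocks op b₁ ρ m))
      rest zero    zero    _  = ε
      rest (suc m) (suc j) eq = from-queue (++-assoc (blocks ρ (suc m)) out block)
        (to-queue (rotation m (inject₁ j) (trans (Fin.toℕ-inject₁ j) (suc-injective eq)) b₁ ρ (out ++ block))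
          (trans (++-assoc out block _) (cong (out ++_) (++-assoc (replicate n₁ one) [ sep ] _))))

  afterBlocks-incr : ∀ r ρ n → afterBlocks (incr r) false ρ n ≡ (false , blocks (ρ [ r ↦ suc (ρ r) ]) n)
  afterBlocks-incr r ρ zero    = refl
  afterBlocks-incr r ρ (suc n) = trans (cong (assemble (ρ n)) (flag (ρ n)))
    (trans (cong (λ (b , w) → b , replicate (proj₂ (afterBlock (incr r) n false (ρ n))) one ++ sep ∷ w) (afterBlocks-incr r ρ n))
      (cong (λ m → false , replicate m one ++ sep ∷ blocks (ρ [ r ↦ suc (ρ r) ]) n) count))
    where
    assemble : ℕ → Bool → Bool × List Letter
    assemble m b = let b₂ , w₂ = afterBlocks (incr r) b ρ n in b₂ , replicate (proj₂ (afterBlock (incr r) n false m)) one ++ sep ∷ w₂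
    flag : ∀ m → proj₁ (afterBlock (incr r) n false m) ≡ false
    flag zero    = refl
    flag (suc m) = refl
    added : ∀ m → proj₂ (afterBlock (incr r) n false m) ≡ (if does (n ≟ r) then suc m else m)
    added zero    = refl
    added (suc m) = refl
    count : proj₂ (afterBlock (incr r) n false (ρ n)) ≡ (ρ [ r ↦ suc (ρ r) ]) n
    count with n ≟ r
    ... | yes refl = trans (added (ρ n)) (cong (λ d → if d then suc (ρ n) else ρ n) (dec-true (n ≟ n) refl))
    ... | no n≢r = trans (added (ρ n)) (cong (λ d → if d then suc (ρ n) else ρ n) (dec-false (n ≟ r) n≢r))

  afterBlocks-decremented : ∀ r ρ n → afterBlocks (decJump r) true ρ n ≡ (true , blocks ρ n)
  afterBlocks-decremented r ρ zero    = refl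
  afterBlocks-decremented r ρ (suc n) with ρ n
  ... | zero  = cong (λ (b , w) → b , sep ∷ w) (afterBlocks-decremented r ρ n)
  ... | suc m = cong (λ (b , w) → b , replicate (suc m) one ++ sep ∷ w) (afterBlocks-decremented r ρ n)

  afterBlocks-zero : ∀ r ρ n → ρ r ≡ 0 → afterBlocks (decJump r) false ρ n ≡ (false , blocks ρ n)
  afterBlocks-zero r ρ zero    eq = refl
  afterBlocks-zero r ρ (suc n) eq with ρ n in eqₙ
  ... | zero  = cong (λ (b , w) → b , sep ∷ w) (afterBlocks-zero r ρ n eq)
  ... | suc m with n ≟ r
  ...   | yes refl = case-absurd (trans (sym eqₙ) eq)
    where case-absurd : ∀ {A : Set} → suc m ≡ 0 → A
          case-absurd ()
  ...   | no n≢r rewrite dec-false (n ≟ r) n≢r = cong (λ (b , w) → b , replicate (suc m) one ++ sep ∷ w) (afterBlocks-zero r ρ n eq)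

  afterBlocks-suc : ∀ r ρ m n → ρ r ≡ suc m → r < n → afterBlocks (decJump r) false ρ n ≡ (true , blocks (ρ [ r ↦ m ]) n)
  afterBlocks-suc r ρ m (suc n) eq r<1+n with n ≟ r
  ... | yes refl rewrite eq | dec-true (n ≟ n) refl = trans
    (cong (λ (b , w) → b , replicate m one ++ sep ∷ w) (afterBlocks-decremented n ρ n))
    (cong (λ w → true , replicate m one ++ sep ∷ w) (blocks-cong n (λ s s<n → sym (update-other ρ m (<⇒≢ s<n)))))
  ... | no n≢r with ρ n
  ...   | zero  = cong (λ (b , w) → b , sep ∷ w) (afterBlocks-suc r ρ m n eq (≤∧≢⇒< (≤-pred r<1+n) (≢-sym n≢r)))
  ...   | suc l rewrite dec-false (n ≟ r) n≢r =
    cong (λ (b , w) → b , replicate (suc l) one ++ sep ∷ w) (afterBlocks-suc r ρ m n eq (≤∧≢⇒< (≤-pred r<1+n) (≢-sym n≢r)))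

  op-run : ∀ p ρ → let b , w = afterBlocks (opAt prog p) false ρ (suc k) in config (just p) ρ ⟶* (start (next p b) , w)
  op-run p ρ = from-queue (sym (++-identityʳ _)) (rotation p k (fromℕ k) (Fin.toℕ-fromℕ k) false ρ [])

  op-run-to : ∀ {op x} p ρ {b ρ′} → opAt prog p ≡ op → next p b ≡ x →
    afterBlocks op false ρ (suc k) ≡ (b , blocks ρ′ (suc k)) → config (just p) ρ ⟶* config x ρ′
  op-run-to p ρ refl refl eq = subst (λ (b , w) → config (just p) ρ ⟶* (start (next p b) , w)) eq (op-run p ρ)

  -- The command `c` sits inside `prog` at the positions `f` and continues at `x`. This is the form
  -- in which the induction on executions can enter subcommands, since the machine always runs all
  -- of `prog`.
  Installed : ∀ c → (Pos c → Pos prog) → Point → Set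
  Installed c f x = ∀ p → opAt prog (f p) ≡ opAt c p × (∀ b → next (f p) b ≡ successor c (just ∘ f) x p b)

  simulate : ∀ {c ρ ρ′} → Exec c ρ ρ′ → bound c ≤ suc k → ∀ {f x} → Installed c f x →
             config (enter c (just ∘ f) x) ρ ⟶* config x ρ′
  simulate {ρ = ρ} (inc {r}) _ {f} inst =
    op-run-to (f tt) ρ (proj₁ (inst tt)) (proj₂ (inst tt) false) (afterBlocks-incr r ρ (suc k))
  simulate nop _ inst = ε
  simulate (_⨟_ {c} {d} e₁ e₂) bnd inst =
    simulate e₁ (≤-trans (m≤m⊔n (bound c) (bound d)) bnd) (inst ∘ inj₁) ◅◅
    simulate e₂ (≤-trans (m≤n⊔m (bound c) (bound d)) bnd) (inst ∘ inj₂)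
  simulate {ρ = ρ} (exit {r} eq) _ {f} inst =
    op-run-to (f nothing) ρ (proj₁ (inst nothing)) (proj₂ (inst nothing) false) (afterBlocks-zero r ρ (suc k) eq)
  simulate {ρ = ρ} (repeat {r} {c} {n = n} eq e₁ e₂) bnd {f} inst =
    op-run-to (f nothing) ρ (proj₁ (inst nothing)) (proj₂ (inst nothing) true)
      (afterBlocks-suc r ρ n (suc k) eq (≤-trans (m≤m⊔n (suc r) (bound c)) bnd)) ◅◅
    simulate e₁ (≤-trans (m≤n⊔m (suc r) (bound c)) bnd) (inst ∘ just) ◅◅
    simulate e₂ bnd inst

  initial : Point
  initial = enter prog just nothing

  halting : ∀ {ρ ρ′} → Exec prog ρ ρ′ → bound prog ≤ suc k → config initial ρ ⟶* config nothing ρ′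
  halting e bnd = simulate e bnd (λ p → refl , λ b → refl)

  -- A simulation run might be empty as far as its type tells; distinct end points guarantee a step.
  long-advance : ∀ {n c c′} → c ⟶* c′ → c ≢ c′ → Long n c′ → Long (suc n) c
  long-advance ε        c≢c  _ = ⊥-elim (c≢c refl)
  long-advance (s ◅ ss) _    l = step s (long-prefix ss l)

  -- The body restores what the test has removed, so the register is positive at every test. Each
  -- pass contributes at least one step, because the test and the body are different control points.
  looping : ∀ {t f x} → (f nothing ≢ f (just tt)) → t < suc k → Installed (loop t (inc t)) f x →
            ∀ n ρ {m} → ρ t ≡ suc m → Long n (config (just (f nothing)) ρ)
  looping                 distinct t<K inst zero    ρ eq = stop
  looping {t} {f} distinct t<K inst (suc n) ρ {m} eq =
    long-advance
      (op-run-to (f nothing) ρ (proj₁ (inst nothing)) (proj₂ (inst nothing) true) (afterBlocks-suc t ρ m (suc k) eq t<K))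
      (λ c≡c → distinct (just-injective (cong (proj₁ ∘ proj₁) c≡c)))
      (long-prefix
        (op-run-to (f (just tt)) ρ₁ (proj₁ (inst (just tt))) (proj₂ (inst (just tt)) false) (afterBlocks-incr t ρ₁ (suc k)))
        (looping distinct t<K inst n (ρ₁ [ t ↦ suc (ρ₁ t) ]) (update-same ρ₁ t _)))
    where ρ₁ = ρ [ t ↦ m ]

-- The game of a queue machine

retract-finite : ∀ {A B : Set} (f : A → B) (g : B → A) → (∀ a → g (f a) ≡ a) → Finite B → Finite A
retract-finite f g gf F = record
  { size = size F ; to = λ a → to F (f a) ; from = λ i → g (from F i)
  ; from-to = λ a → trans (cong g (from-to F (f a))) (gf a) }

pattern x₀ = zero
pattern x₁ = suc zero
pattern 𝐳  = suc (suc zero)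

I₃ : Set
I₃ = Instr 3 3

Msg : Set
Msg = Fin 3 × Fin 3

module _ {S : Set} (fin : Finite S) (out : S → List (I₃ × S)) where

  edge : S → I₃ × S → Fin (size fin) × I₃ × Fin (size fin)
  edge s (i , s′) = to fin s , i , to fin s′

  -- The coding of S need not be onto: a junk code n contributes the edges of from n again.
  automaton : Process 3 3
  automaton = process (size fin) (concatMap (λ n → map (edge (from fin n)) (out (from fin n))) (allFin (size fin)))

  automaton⁺ : ∀ {s i s′} → (i , s′) ∈ out s → (to fin s , i , to fin s′) ∈ δ automaton
  automaton⁺ {s} {i} {s′} m = ∈-concatMap⁺ _ (Any.map (λ { refl → at (from-to fin s) }) (∈-allFin (to fin s)))
    where
    at : ∀ {t} → t ≡ s → (to fin s , i , to fin s′) ∈ map (edge t) (out t)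
    at refl = ∈-map⁺ (edge s) m

  -- The edge may stem from a junk code `k`, but its source is `to fin (from fin k)`, so
  -- `from fin k` is `s` all the same.
  automaton⁻ : ∀ {n i n′} s → (n , i , n′) ∈ δ automaton → n ≡ to fin s → Σ S λ s′ → (i , s′) ∈ out s × n′ ≡ to fin s′
  automaton⁻ s m refl with Any.satisfied (∈-concatMap⁻ _ {xs = allFin (size fin)} m)
  ... | k , m′ with ∈-map⁻ (edge (from fin k)) m′
  ...   | (i , s′) , mem , eq with refl ← cong (λ t → proj₁ (proj₂ t)) eq =
    s′ , subst (λ t → (i , s′) ∈ out t) (same (cong proj₁ eq)) mem , cong (λ t → proj₂ (proj₂ t)) eq
    where
    same : ∀ {t} → to fin s ≡ to fin t → t ≡ s
    same {t} e = trans (sym (from-to fin t)) (trans (cong (from fin) (sym e)) (from-to fin s))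

-- The states with argument `just d` handle the letter `d`, those with argument `nothing` handle its
-- tick.
data Receiver : Set where
  win wait₀ wait₁           : Receiver
  got fence check publish   : Maybe Letter → Receiver

receiver-finite : Finite Receiver
receiver-finite = retract-finite enc dec dec-enc (product-finite (fin-finite 5) (maybe-finite letter-finite))
  where
  enc : Receiver → Fin 5 × Maybe Letter
  enc wait₀       = zero , nothing
  enc wait₁       = zero , just one
  enc win         = zero , just sep
  enc (got p)     = suc zero , p
  enc (fence p)   = suc (suc zero) , p
  enc (check p)   = suc (suc (suc zero)) , p
  enc (publish p) = suc (suc (suc (suc zero))) , p
  dec : Fin 5 × Maybe Letter → Receiver
  dec (zero , nothing)                   = wait₀
  dec (zero , just one)                  = wait₁
  dec (zero , just sep)                  = win
  dec (suc zero , p)                     = got p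
  dec (suc (suc zero) , p)               = fence p
  dec (suc (suc (suc zero)) , p)         = check p
  dec (suc (suc (suc (suc zero))) , p)   = publish p
  dec-enc : ∀ r → dec (enc r) ≡ r
  dec-enc win         = refl
  dec-enc wait₀       = refl
  dec-enc wait₁       = refl
  dec-enc (got _)     = refl
  dec-enc (fence _)   = refl
  dec-enc (check _)   = refl
  dec-enc (publish _) = refl

val : Letter → Fin 3
val one = suc zero
val sep = suc (suc zero)

val-injective : ∀ {d e} → val d ≡ val e → d ≡ e
val-injective {one} {one} _ = refl
val-injective {sep} {sep} _ = refl

val≢0 : ∀ {d} → val d ≢ zero
val≢0 {one} ()
val≢0 {sep} ()

pattern tick = (suc zero , suc zero)

-- A letter d travels as the two messages x₀ := val d, tick.  The receiver moves to win
-- when it sees that a further message was updated before it had reset the variable of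
-- the current one.
receiver : Receiver → List (I₃ × Receiver)
receiver win                = []
receiver wait₀              = (rd x₀ (val one) , got (just one)) ∷ (rd x₀ (val sep) , got (just sep)) ∷ (rd x₁ (suc zero) , win) ∷ []
receiver (got (just d))     = [ wr x₀ zero , fence (just d) ]
-- The fence puts the reset into memory before the other variable is tested. It also forces the
-- preceding write to `z` out of the buffer.
receiver (fence p)          = [ mf , check p ]
receiver (check (just d))   = (rd x₁ zero , publish (just d)) ∷ (rd x₁ (suc zero) , win) ∷ []
receiver (publish (just d)) = [ wr 𝐳 (val d) , wait₁ ]
receiver wait₁              = (rd x₁ (suc zero) , got nothing) ∷ (rd x₀ (val one) , win) ∷ (rd x₀ (val sep) , win) ∷ []
receiver (got nothing)      = [ wr x₁ zero , fence nothing ]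
receiver (check nothing)    = (rd x₀ zero , publish nothing) ∷ (rd x₀ (val one) , win) ∷ (rd x₀ (val sep) , win) ∷ []
receiver (publish nothing)  = [ wr 𝐳 zero , wait₀ ]

receiverP : Process 3 3
receiverP = automaton receiver-finite receiver

-- When the update player withholds all messages, sender and receiver may both be blocked; a play
-- that ended there would be lost for the process player.
idlerP : Process 3 3
idlerP = process 1 [ zero , skip , zero ]

pattern 𝕊 = zero
pattern ℝ = suc zero
pattern 𝕀 = suc (suc zero)

module Game (M : QueueMachine) where
  open QueueMachine M
  open Runs M

  Local : Set
  Local = Q × Maybe Letter

  local-finite : Finite Local
  local-finite = product-finite finite (maybe-finite letter-finite)

  performing : Q → Action Q → Maybe Letter → List (I₃ × Local)
  performing q halt        _          = []
  performing q (recv f)    nothing    = (rd 𝐳 (val one) , q , just one) ∷ (rd 𝐳 (val sep) , q , just sep) ∷ []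
  -- Waiting for `z` to be cleared prevents the next receive from reading the same letter again.
  performing q (recv f)    (just d)   = [ rd 𝐳 zero , f d , nothing ]
  performing q (send e q′) nothing    = [ wr x₀ (val e) , q , just one ]
  performing q (send e q′) (just one) = [ wr x₁ (suc zero) , q′ , nothing ]
  performing q (send e q′) (just sep) = []

  -- (q , just d) is the state between the two instructions by which the sender
  -- receives d, or sends a letter (then d = one).
  sender : Local → List (I₃ × Local)
  sender (q , l) = performing q (act q) l

  senderP : Process 3 3
  senderP = automaton local-finite sender

  program : Vec (Process 3 3) 3
  program = senderP ∷ receiverP ∷ idlerP ∷ []

  open TSO program public

  isHalt : Action Q → Bool
  isHalt halt = true
  isHalt _    = false

  haltSet : PerProc StateSet program
  haltSet = Vec.tabulate (λ n → isHalt (act (proj₁ (from local-finite n)))) ∷ Vec.replicate _ false ∷ Vec.replicate _ false ∷ []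

  conf : Local → Receiver → List Msg → List Msg → (x y z : Fin 3) → Conf
  conf l r bs br x y z = ⟨ to local-finite l ∷ to receiver-finite r ∷ zero ∷ [] , bs ∷ br ∷ [] ∷ [] , x ∷ y ∷ z ∷ [] ⟩

  data FromSender : Msg → Set where
    letterᵐ : ∀ d → FromSender (x₀ , val d)
    tickᵐ   : FromSender tick

  -- The sender never writes to `z`, so its reads of `z` always go to memory.
  latest-𝐳 : ∀ {bs} → All FromSender bs → latest 𝐳 bs ≡ nothing
  latest-𝐳 []               = refl
  latest-𝐳 (letterᵐ d ∷ ms) = latest-𝐳 ms
  latest-𝐳 (tickᵐ ∷ ms)     = latest-𝐳 ms

  data SMove : Local → Fin 3 → List Msg → Local → List Msg → Set where
    take : ∀ {q f bs z} → act q ≡ recv f → ∀ d → z ≡ val d → SMove (q , nothing) z bs (q , just d) bs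
    done : ∀ {q f bs z d} → act q ≡ recv f → z ≡ zero → SMove (q , just d) z bs (f d , nothing) bs
    put  : ∀ {q e q′ bs z} → act q ≡ send e q′ → SMove (q , nothing) z bs (q , just one) ((x₀ , val e) ∷ bs)
    tock : ∀ {q e q′ bs z} → act q ≡ send e q′ → SMove (q , just one) z bs (q′ , nothing) (tick ∷ bs)

  sender-step : ∀ {l r bs br x y z c′} → All FromSender bs → ProcStep (conf l r bs br x y z) 𝕊 c′ →
    Σ Local λ l′ → Σ (List Msg) λ bs′ → SMove l z bs l′ bs′ × c′ ≡ conf l′ r bs′ br x y z
  sender-step {l = q , k} {bs = bs} {z = z} ms ((n , i , n′) , mem , n≡ , en , c′≡)
    with automaton⁻ local-finite sender (q , k) mem n≡
  ... | l′ , mem′ , refl with act q in eq | k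
  sender-step ms (_ , _ , _ , en , refl) | l′ , here refl , refl | recv f | nothing =
    _ , _ , take eq one (trans (cong (maybe′ _ _) (sym (latest-𝐳 ms))) en) , refl
  sender-step ms (_ , _ , _ , en , refl) | l′ , there (here refl) , refl | recv f | nothing =
    _ , _ , take eq sep (trans (cong (maybe′ _ _) (sym (latest-𝐳 ms))) en) , refl
  sender-step ms (_ , _ , _ , en , refl) | l′ , here refl , refl | recv f | just d =
    _ , _ , done eq (trans (cong (maybe′ _ _) (sym (latest-𝐳 ms))) en) , refl
  sender-step ms (_ , _ , _ , en , refl) | l′ , here refl , refl | send e q′ | nothing = _ , _ , put eq , refl
  sender-step ms (_ , _ , _ , en , refl) | l′ , here refl , refl | send e q′ | just one = _ , _ , tock eq , refl


  sender-enabled : ∀ {l r bs br x y z l′ bs′} → All FromSender bs → SMove l z bs l′ bs′ → ProcEnabled (conf l r bs br x y z) 𝕊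
  sender-enabled {l = q , k} {r} {bs} {br} {x} {y} {z} ms = go
    where
    c = conf (q , k) r bs br x y z
    offer : ∀ {a i l′} → act q ≡ a → (i , l′) ∈ performing q a k → Enabled c 𝕊 i → ProcEnabled c 𝕊
    offer refl m en = _ , automaton⁺ local-finite sender m , refl , en
    go : ∀ {l′ bs′} → SMove (q , k) z bs l′ bs′ → ProcEnabled c 𝕊
    go (take eq one refl) = offer eq (here refl) (cong (maybe′ _ _) (latest-𝐳 ms))
    go (take eq sep refl) = offer eq (there (here refl)) (cong (maybe′ _ _) (latest-𝐳 ms))
    go (done eq refl)     = offer eq (here refl) (cong (maybe′ _ _) (latest-𝐳 ms))
    go (put eq)           = offer eq (here refl) tt
    go (tock eq)          = offer eq (here refl) tt

  seen : Fin 3 → Fin 3 → List Msg → Fin 3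
  seen x v br = maybe′ (λ d → d) v (latest x br)

  data RMove (x y : Fin 3) (br : List Msg) : Receiver → Receiver → List Msg → Set where
    receive₀ : ∀ d → seen x₀ x br ≡ val d → RMove x y br wait₀ (got (just d)) br
    win₀     : seen x₁ y br ≡ suc zero → RMove x y br wait₀ win br
    reset₀   : ∀ {d} → RMove x y br (got (just d)) (fence (just d)) ((x₀ , zero) ∷ br)
    fenced   : ∀ {p} → br ≡ [] → RMove x y br (fence p) (check p) br
    pass₀    : ∀ {d} → seen x₁ y br ≡ zero → RMove x y br (check (just d)) (publish (just d)) br
    caught₀  : ∀ {d} → seen x₁ y br ≡ suc zero → RMove x y br (check (just d)) win br
    publish₀ : ∀ {d} → RMove x y br (publish (just d)) wait₁ ((𝐳 , val d) ∷ br)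
    receive₁ : seen x₁ y br ≡ suc zero → RMove x y br wait₁ (got nothing) br
    win₁     : ∀ d → seen x₀ x br ≡ val d → RMove x y br wait₁ win br
    reset₁   : RMove x y br (got nothing) (fence nothing) ((x₁ , zero) ∷ br)
    pass₁    : seen x₀ x br ≡ zero → RMove x y br (check nothing) (publish nothing) br
    caught₁  : ∀ d → seen x₀ x br ≡ val d → RMove x y br (check nothing) win br
    publish₁ : RMove x y br (publish nothing) wait₀ ((𝐳 , zero) ∷ br)

  receiver-step : ∀ {l r bs br x y z c′} → ProcStep (conf l r bs br x y z) ℝ c′ →
    Σ Receiver λ r′ → Σ (List Msg) λ br′ → RMove x y br r r′ br′ × c′ ≡ conf l r′ bs br′ x y z
  receiver-step {l = l} {r} {bs} {br} {x} {y} {z} ((n , i , n′) , mem , n≡ , en , c′≡)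
    with automaton⁻ receiver-finite receiver r mem n≡
  ... | r′ , mem′ , refl = go r mem′ en c′≡
    where
    c : Receiver → Conf
    c r = conf l r bs br x y z
    go : ∀ r {i r′ c′} → (i , r′) ∈ receiver r → Enabled (c r) ℝ i → c′ ≡ exec (c r) ℝ i (to receiver-finite r′) →
      Σ Receiver λ r′ → Σ (List Msg) λ br′ → RMove x y br r r′ br′ × c′ ≡ conf l r′ bs br′ x y z
    go wait₀ (here refl) en refl                 = _ , _ , receive₀ one en , refl
    go wait₀ (there (here refl)) en refl         = _ , _ , receive₀ sep en , refl
    go wait₀ (there (there (here refl))) en refl = _ , _ , win₀ en , refl
    go wait₁ (here refl) en refl                 = _ , _ , receive₁ en , refl
    go wait₁ (there (here refl)) en refl         = _ , _ , win₁ one en , refl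
    go wait₁ (there (there (here refl))) en refl = _ , _ , win₁ sep en , refl
    go (got (just d)) (here refl) en refl        = _ , _ , reset₀ , refl
    go (got nothing) (here refl) en refl         = _ , _ , reset₁ , refl
    go (fence p) (here refl) en refl             = _ , _ , fenced en , refl
    go (check (just d)) (here refl) en refl         = _ , _ , pass₀ en , refl
    go (check (just d)) (there (here refl)) en refl = _ , _ , caught₀ en , refl
    go (check nothing) (here refl) en refl                 = _ , _ , pass₁ en , refl
    go (check nothing) (there (here refl)) en refl         = _ , _ , caught₁ one en , refl
    go (check nothing) (there (there (here refl))) en refl = _ , _ , caught₁ sep en , refl
    go (publish (just d)) (here refl) en refl    = _ , _ , publish₀ , refl
    go (publish nothing) (here refl) en refl     = _ , _ , publish₁ , refl

  receiver-enabled : ∀ {l r bs br x y z r′ br′} → RMove x y br r r′ br′ → ProcEnabled (conf l r bs br x y z) ℝ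
  receiver-enabled {l} {r} {bs} {br} {x} {y} {z} = go
    where
    c = conf l r bs br x y z
    offer : ∀ {i r′} → (i , r′) ∈ receiver r → Enabled c ℝ i → ProcEnabled c ℝ
    offer m en = _ , automaton⁺ receiver-finite receiver m , refl , en
    go : ∀ {r′ br′} → RMove x y br r r′ br′ → ProcEnabled c ℝ
    go (receive₀ one en) = offer (here refl) en
    go (receive₀ sep en) = offer (there (here refl)) en
    go (win₀ en)         = offer (there (there (here refl))) en
    go reset₀            = offer (here refl) tt
    go (fenced en)       = offer (here refl) en
    go (pass₀ en)        = offer (here refl) en
    go (caught₀ en)      = offer (there (here refl)) en
    go publish₀          = offer (here refl) tt
    go (receive₁ en)     = offer (here refl) en
    go (win₁ one en)     = offer (there (here refl)) en
    go (win₁ sep en)     = offer (there (there (here refl))) en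
    go reset₁            = offer (here refl) tt
    go (pass₁ en)        = offer (here refl) en
    go (caught₁ one en)  = offer (there (here refl)) en
    go (caught₁ sep en)  = offer (there (there (here refl))) en
    go publish₁          = offer (here refl) tt

  idle : ∀ c → ProcStep c 𝕀 (exec c 𝕀 skip zero)
  idle ⟨ s , b , m ⟩ = (zero , skip , zero) , here refl , unique _ , tt , refl
    where
    unique : ∀ (i : Fin 1) → zero ≡ i
    unique zero = refl

  idler-step : ∀ {l r bs br x y z c′} → ProcStep (conf l r bs br x y z) 𝕀 c′ → c′ ≡ conf l r bs br x y z
  idler-step ((_ , _ , _) , here refl , _ , _ , c′≡) = c′≡

  -- The queue lists the oldest letter first and the buffer the newest message first, so the order
  -- is reversed and each tick stands to the left of its letter.
  messages : List Letter → List Msg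
  messages []      = []
  messages (d ∷ w) = (messages w ++ [ tick ]) ++ [ x₀ , val d ]

  messages-snoc : ∀ w e → messages (w ++ [ e ]) ≡ tick ∷ (x₀ , val e) ∷ messages w
  messages-snoc []      e = refl
  messages-snoc (d ∷ w) e rewrite messages-snoc w e = refl

  messages-valid : ∀ w → All FromSender (messages w)
  messages-valid []      = []
  messages-valid (d ∷ w) = All.++⁺ (All.++⁺ (messages-valid w) (tickᵐ ∷ [])) (letterᵐ d ∷ [])

  represent : QConf → Conf
  represent (q , w) = conf (q , nothing) wait₀ (messages w) [] zero zero zero

-- Halting machines: the update player wins

module _ {nX nV nI} {prog : Vec (Process nX nV) nI} where

  open TSO prog

  -- Along a chain only one process at a time can change the configuration that the process
  -- player finds at its next turn, so that fairness drives every play along the chain.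
  module Answered (F : PerProc StateSet prog)
    (reply : ∀ c → Σ Conf (Star Update c)) (movable : ∀ c → ∃ (Move (A , c))) where

    response : Conf → Conf
    response c = proj₁ (reply c)

    Progress : Conf → Fin nI → Conf → Set
    Progress c ι c′ = ProcEnabled c ι ×
      (∀ κ c₁ → ProcStep c κ c₁ → (κ ≢ ι × response c₁ ≡ c) ⊎ (response c₁ ≡ c′))

    data Chain : Conf → Set where
      halted : ∀ {c} → InCF F (A , c) → Chain c
      link   : ∀ {c c′} ι → Progress c ι c′ → Chain c′ → Chain c

    respond : Strategy
    respond h (A , c) = A , c
    respond h (B , c) = A , response c

    respond-legal : Legal B respond
    respond-legal h (B , c) _ _ = proj₂ (reply c)

    module _ (σ : Strategy) (legal : Legal A σ) (c₀ : Conf) where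

      position : ℕ → List GConf × GConf
      position zero    = [] , (A , c₀)
      position (suc k) = let h , g = position k in g ∷ h , choose σ respond h g

      play : ℕ → GConf
      play k = proj₂ (position k)

      play-hist : ∀ k → hist play k ≡ proj₁ (position k)
      play-hist zero    = refl
      play-hist (suc k) = cong (play k ∷_) (play-hist k)

      play-choose : ∀ k → play (suc k) ≡ choose σ respond (hist play k) (play k)
      play-choose k = cong (λ h → choose σ respond h (play k)) (sym (play-hist k))

      choose-move : ∀ h g → Move g (choose σ respond h g)
      choose-move h (A , c) = legal h (A , c) refl (movable c)
      choose-move h (B , c) = respond-legal h (B , c) refl ((A , c) , ε)

      outcome : InfOutcome σ respond (A , c₀) play
      outcome = refl , (λ k → choose-move _ (play k)) , play-choose

      round : ∀ {k c} → play k ≡ (A , c) → Σ (Fin nI) λ ι → Σ Conf λ c₁ →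
        ProcStep c ι c₁ × play (1 + k) ≡ (B , c₁) × play (2 + k) ≡ (A , response c₁)
      round {k} {c} eq with position k | eq | choose-move (proj₁ (position k)) (play k)
      ... | h , g | refl | move with σ h (A , c) | move
      ...   | B , c₁ | ι , st = ι , c₁ , st , refl , refl

      -- By induction on the chain the play can never reach `c′`. So every round returns to `c`,
      -- where `ι` is enabled at each turn but never moves, against fairness.
      fair-contradiction : W-P play → (∀ k → ¬ InCF F (play k)) →
        ∀ {c} → Chain c → ∀ k → play k ≢ (A , c)
      fair-contradiction fair safe (halted f) k eq = safe k (subst (InCF F) (sym eq) f)
      fair-contradiction fair safe (link {c} {c′} ι (enabled , progress) chain) k₀ eq₀ =
        -- The turns of the process player from `k₀` on are the positions of the parity of `k₀`, and
        -- `stays` finds the play at `c` in all of them.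
        let k , k₀≤k , turn , st = fair ι (λ n → n * 2 + k₀ , ≤-trans (m≤m*n n 2) (m≤m+n (n * 2) k₀)
                                   , cong proj₁ (stays n) , subst (λ g → ProcEnabled (proj₂ g) ι) (sym (stays n)) enabled) k₀
        in executed k (at-turn k k₀≤k turn) st
        where
        Here : ℕ → Set
        Here k = play k ≡ (A , c)
        next : ∀ k → Here k → Here (2 + k)
        next k eq with round {k} eq
        ... | κ , c₁ , st , _ , eq₂ with progress κ c₁ st
        ...   | inj₁ (_ , same) = trans eq₂ (cong (A ,_) same)
        ...   | inj₂ moved      = ⊥-elim (fair-contradiction fair safe chain (2 + k) (trans eq₂ (cong (A ,_) moved)))
        stays : ∀ n → Here (n * 2 + k₀)
        stays zero    = eq₀
        stays (suc n) = next (n * 2 + k₀) (stays n)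
        alternate : ∀ d → Here (d + k₀) × proj₁ (play (1 + d + k₀)) ≡ B ⊎ Here (1 + d + k₀) × proj₁ (play (d + k₀)) ≡ B
        alternate zero = inj₁ (eq₀ , let _ , _ , _ , eq₁ , _ = round {k₀} eq₀ in cong proj₁ eq₁)
        alternate (suc d) with alternate d
        ... | inj₁ (now , other) = inj₂ (next (d + k₀) now , other)
        ... | inj₂ (now , _)      = inj₁ (now , let _ , _ , _ , eq₁ , _ = round {1 + d + k₀} now in cong proj₁ eq₁)
        at-turn : ∀ k → k₀ ≤ k → proj₁ (play k) ≡ A → Here k
        at-turn k k₀≤k turn = subst Here (m∸n+n≡m k₀≤k) (turn-here (alternate (k ∸ k₀)))
          where
          turn-here : _ → Here (k ∸ k₀ + k₀)
          turn-here (inj₁ (now , _)) = now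
          turn-here (inj₂ (_ , isB)) with () ← trans (sym (trans (cong (λ k → proj₁ (play k)) (m∸n+n≡m k₀≤k)) turn)) isB
        executed : ∀ k → Here k → ¬ ProcStep (proj₂ (play k)) ι (proj₂ (play (suc k)))
        executed k eq st with round {k} eq
        ... | κ , c₁ , _ , eq₁ , eq₂ with progress ι c₁ (subst₂ (λ g g′ → ProcStep (proj₂ g) ι (proj₂ g′)) eq eq₁ st)
        ...   | inj₁ (ι≢ι , _) = ι≢ι refl
        ...   | inj₂ moved     = fair-contradiction fair safe chain (2 + k) (trans eq₂ (cong (A ,_) moved))

    chain-loses : ∀ {c} → Chain c → ¬ AWins (W-SP F) (A , c)
    chain-loses {c} chain (σ , legal , wins) =
      let safe , fair = proj₁ (wins respond respond-legal) (play σ legal c) (outcome σ legal c)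
      in fair-contradiction σ legal c fair safe chain 0 refl

initLast-∷ʳ : ∀ {A : Set} (xs : List A) x → initLast (xs ∷ʳ x) ≡ xs ∷ʳ′ x
initLast-∷ʳ []       x = refl
initLast-∷ʳ (_ ∷ xs) x rewrite initLast-∷ʳ xs x = refl

module Halting (M : QueueMachine) where
  open QueueMachine M
  open Runs M
  open Game M

  isRecv : Action Q → Bool
  isRecv (recv _) = true
  isRecv _        = false

  -- The update player delivers the next message of the sender only when both the sender
  -- and the receiver are waiting for it.
  delivers : Local → Receiver → Fin 3 → Fin 3 → Bool
  delivers (q , nothing) wait₀ zero y    = isRecv (act q)
  delivers (q , just d)  wait₁ x    zero = isRecv (act q)
  delivers _             _     _    _    = false

  Reply : Conf → Set
  Reply c = Σ Conf λ c′ → Star Update c c′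

  -- A write of the receiver is updated at once. Along the chains its buffer therefore never holds
  -- more than one message, and its fences do not block.
  reply : ∀ c → Reply c
  reply c@(⟨ l ∷ r ∷ w ∷ [] , bs ∷ ((y , d) ∷ []) ∷ bw ∷ [] , m ⟩) = _ , (ℝ , [] , y , d , refl , refl) ◅ ε
  reply c@(⟨ l ∷ r ∷ w ∷ [] , bs ∷ [] ∷ bw ∷ [] , m@(x ∷ y ∷ z ∷ []) ⟩) =
    deliver (delivers (from local-finite l) (from receiver-finite r) x y) (initLast bs)
    where
    deliver : ∀ {bs} → Bool → InitLast bs → Reply ⟨ l ∷ r ∷ w ∷ [] , bs ∷ [] ∷ bw ∷ [] , m ⟩
    deliver true (bs ∷ʳ′ (y , d)) = _ , (𝕊 , bs , y , d , refl , refl) ◅ ε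
    deliver _    _                = _ , ε
  reply c = c , ε

  open Answered haltSet reply (λ c → (B , exec c 𝕀 skip zero) , 𝕀 , idle c)

  response-stay : ∀ {l r bs x y z} → delivers l r x y ≡ false →
    response (conf l r bs [] x y z) ≡ conf l r bs [] x y z
  response-stay {l} {r} eq rewrite from-to local-finite l | from-to receiver-finite r | eq = refl

  response-deliver : ∀ {l r bs y d x₀′ x₁′ z} → delivers l r x₀′ x₁′ ≡ true →
    response (conf l r (bs ++ [ y , d ]) [] x₀′ x₁′ z) ≡
    ⟨ s (conf l r bs [] x₀′ x₁′ z) , bs ∷ [] ∷ [] ∷ [] , (x₀′ ∷ x₁′ ∷ z ∷ []) [ y ]≔ d ⟩
  response-deliver {l} {r} {bs} {y} {d} eq rewrite from-to local-finite l | from-to receiver-finite r | eq | initLast-∷ʳ bs (y , d) = refl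

  sender-progress : ∀ {l r bs x y z l′ bs′ c′} → All FromSender bs → SMove l z bs l′ bs′ →
    delivers l r x y ≡ false →
    (∀ {l′ bs′} → SMove l z bs l′ bs′ → response (conf l′ r bs′ [] x y z) ≡ c′) →
    (∀ {r′ br′} → ¬ RMove x y [] r r′ br′) →
    Progress (conf l r bs [] x y z) 𝕊 c′
  sender-progress {l} {r} {bs} {x} {y} {z} {c′ = c′} ms move stay moves blocked = sender-enabled {l} {r} ms move , λ where
    𝕊 c₁ st → let _ , _ , m , eq = sender-step {l} {r} ms st in inj₂ (trans (cong response eq) (moves m))
    ℝ c₁ st → let _ , _ , m , _ = receiver-step {l} {r} {bs} st in ⊥-elim (blocked m)
    𝕀 c₁ st → inj₁ ((λ ()) , trans (cong response (idler-step {l} {r} {bs} st)) (response-stay {l} {r} stay))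

  receiver-progress : ∀ {l r bs x y z r′ br′ c′} → All FromSender bs → RMove x y [] r r′ br′ →
    delivers l r x y ≡ false →
    (∀ {r′ br′} → RMove x y [] r r′ br′ → response (conf l r′ bs br′ x y z) ≡ c′) →
    (∀ {l′ bs′} → ¬ SMove l z bs l′ bs′) →
    Progress (conf l r bs [] x y z) ℝ c′
  receiver-progress {l} {r} {bs} {x} {y} {z} ms move stay moves blocked = receiver-enabled {l} {r} {bs} move , λ where
    𝕊 c₁ st → let _ , _ , m , _ = sender-step {l} {r} ms st in ⊥-elim (blocked m)
    ℝ c₁ st → let _ , _ , m , eq = receiver-step {l} {r} {bs} st in inj₂ (trans (cong response eq) (moves m))
    𝕀 c₁ st → inj₁ ((λ ()) , trans (cong response (idler-step {l} {r} {bs} st)) (response-stay {l} {r} stay))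

  waiting-blocked : ∀ {q f bs} → act q ≡ recv f → ∀ {l′ bs′} → ¬ SMove (q , nothing) zero bs l′ bs′
  waiting-blocked eq (take _ d z≡) = val≢0 (sym z≡)
  waiting-blocked eq (put eq′) with () ← trans (sym eq) eq′

  taken-blocked : ∀ {q f d bs} → act q ≡ recv f → ∀ {l′ bs′} → ¬ SMove (q , just d) (val d) bs l′ bs′
  taken-blocked eq (done _ z≡) = val≢0 z≡
  taken-blocked eq (tock eq′) with () ← trans (sym eq) eq′

  idle₀ : ∀ {r′ br′} → ¬ RMove zero zero [] wait₀ r′ br′
  idle₀ (receive₀ _ e) = val≢0 (sym e)
  idle₀ (win₀ ())

  idle₁ : ∀ {r′ br′} → ¬ RMove zero zero [] wait₁ r′ br′
  idle₁ (receive₁ ())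
  idle₁ (win₁ _ e) = val≢0 (sym e)

  isRecv-recv : ∀ {q f} → act q ≡ recv f → isRecv (act q) ≡ true
  isRecv-recv eq rewrite eq = refl

  not-delivering : ∀ {q} d {y} → delivers (q , nothing) wait₀ (val d) y ≡ false
  not-delivering one = refl
  not-delivering sep = refl

  -- The twelve links are the round trip of a letter: five moves of the receiver and one of the
  -- sender for the value, then the same for the tick. The replies deliver the value before the
  -- first link and the tick when the sender has taken the letter.
  recv-chain : ∀ {q f d w} → act q ≡ recv f → Chain (response (represent (f d , w))) → Chain (response (represent (q , d ∷ w)))
  recv-chain {q} {f} {d} {w} eq chain = subst Chain (sym (response-deliver {q , nothing} {wait₀} (isRecv-recv eq)))
    (link ℝ (receiver-progress ms₁ (receive₀ d refl) (not-delivering d)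
        (λ { (receive₀ e eq) → subst (λ e → response (conf (q , nothing) (got (just e)) b₁ [] (val d) zero zero) ≡ _)
               (val-injective eq) (response-stay {q , nothing} {got (just d)} refl) ; (win₀ ()) })
        (waiting-blocked eq))
    (link ℝ (receiver-progress ms₁ reset₀ refl (λ { reset₀ → refl }) (waiting-blocked eq))
    (link ℝ (receiver-progress {r = fence (just d)} ms₁ (fenced refl) refl
        (λ { (fenced _) → response-stay {q , nothing} {check (just d)} refl }) (waiting-blocked eq))
    (link ℝ (receiver-progress {r = check (just d)} ms₁ (pass₀ refl) refl
        (λ { (pass₀ _) → response-stay {q , nothing} {publish (just d)} refl ; (caught₀ ()) }) (waiting-blocked eq))
    (link ℝ (receiver-progress {r = publish (just d)} ms₁ publish₀ refl (λ { publish₀ → refl }) (waiting-blocked eq))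
    (link 𝕊 (sender-progress {r = wait₁} ms₁ (take eq d refl) refl
        (λ { (take _ e eq′) → subst (λ e → response (conf (q , just e) wait₁ b₁ [] zero zero (val d)) ≡ _)
               (val-injective eq′) (response-deliver {q , just d} {wait₁} (isRecv-recv eq))
           ; (put eq′) → ⊥-elim (recv≢send eq eq′) }) idle₁)
    (link ℝ (receiver-progress {r = wait₁} ms₀ (receive₁ refl) refl
        (λ { (receive₁ _) → response-stay {q , just d} {got nothing} refl ; (win₁ _ e) → ⊥-elim (val≢0 (sym e)) }) (taken-blocked eq))
    (link ℝ (receiver-progress {r = got nothing} ms₀ reset₁ refl (λ { reset₁ → refl }) (taken-blocked eq))
    (link ℝ (receiver-progress {r = fence nothing} ms₀ (fenced refl) refl
        (λ { (fenced _) → response-stay {q , just d} {check nothing} refl }) (taken-blocked eq))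
    (link ℝ (receiver-progress {r = check nothing} ms₀ (pass₁ refl) refl
        (λ { (pass₁ _) → response-stay {q , just d} {publish nothing} refl ; (caught₁ _ e) → ⊥-elim (val≢0 (sym e)) }) (taken-blocked eq))
    (link ℝ (receiver-progress {r = publish nothing} ms₀ publish₁ refl (λ { publish₁ → refl }) (taken-blocked eq))
    (link 𝕊 (sender-progress {r = wait₀} ms₀ (done eq refl) refl
        (λ { (done eq′ _) → cong (λ g → response (represent (g d , w))) (recv-injective (trans (sym eq′) eq))
           ; (tock eq′) → ⊥-elim (recv≢send eq eq′) }) idle₀)
    chain))))))))))))
    where
    b₀ = messages w
    b₁ = b₀ ++ [ tick ]
    ms₀ = messages-valid w
    ms₁ : All FromSender b₁
    ms₁ = All.++⁺ ms₀ (tickᵐ ∷ [])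
    recv≢send : ∀ {q f e q′} → act q ≡ recv f → act q ≢ send e q′
    recv≢send eq eq′ with () ← trans (sym eq) eq′
    recv-injective : ∀ {f g : Letter → Q} → recv f ≡ recv g → f ≡ g
    recv-injective refl = refl

  send-chain : ∀ {q e q′ w} → act q ≡ send e q′ → Chain (response (represent (q′ , w ++ [ e ]))) → Chain (represent (q , w))
  send-chain {q} {e} {q′} {w} eq chain =
    link 𝕊 (sender-progress {r = wait₀} ms (put eq) still
      (λ { (take eq′ _ _) → ⊥-elim (send≢recv eq′)
         ; (put eq′) → trans (cong (λ e → response (conf (q , just one) wait₀ ((x₀ , val e) ∷ messages w) [] zero zero zero)) (proj₁ (same eq′)))
                         (response-stay {q , just one} {wait₀} refl) }) idle₀)
    (link 𝕊 (sender-progress {r = wait₀} (letterᵐ e ∷ ms) (tock eq) refl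
      (λ { (done eq′ _) → ⊥-elim (send≢recv eq′)
         ; (tock eq′) → cong₂ (λ q b → response (conf (q , nothing) wait₀ b [] zero zero zero)) (proj₂ (same eq′)) (sym (messages-snoc w e)) }) idle₀)
    chain)
    where
    ms = messages-valid w
    send≢recv : ∀ {f} → act q ≢ recv f
    send≢recv eq′ with () ← trans (sym eq) eq′
    same : ∀ {e₁ q₁} → act q ≡ send e₁ q₁ → e₁ ≡ e × q₁ ≡ q′
    same eq′ with refl ← trans (sym eq) eq′ = refl , refl
    still : isRecv (act q) ≡ false
    still rewrite eq = refl

  response-represent : ∀ {q w} → isRecv (act q) ≡ false → response (represent (q , w)) ≡ represent (q , w)
  response-represent {q} eq = response-stay {q , nothing} {wait₀} eq

  halt-chain : ∀ {q w} → act q ≡ halt → Chain (represent (q , w))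
  halt-chain {q} eq = halted (𝕊 , trans (lookup∘tabulate _ (to local-finite (q , nothing)))
    (trans (cong (λ l → isHalt (act (proj₁ l))) (from-to local-finite (q , nothing))) (cong isHalt eq)))

  run-chain : ∀ {c q w} → c ⟶* (q , w) → act q ≡ halt → Chain (response (represent c))
  run-chain {q = q} {w} ε eq = subst Chain (sym (response-represent {q} {w} (cong isRecv eq))) (halt-chain {w = w} eq)
  run-chain (recvS {w = w} eq ◅ ss) h = recv-chain {w = w} eq (run-chain ss h)
  run-chain (sendS {q} {w = w} eq ◅ ss) h = subst Chain (sym (response-represent {q} {w} (cong isRecv eq))) (send-chain {w = w} eq (run-chain ss h))

  start-chain : ∀ {c q w} → c ⟶* (q , w) → act q ≡ halt → Chain (represent c)
  start-chain {w = w} ε               h = halt-chain {w = w} h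
  start-chain (sendS {w = w} eq ◅ ss) h = send-chain {w = w} eq (run-chain ss h)
  -- The play begins with a turn of the process player, before any delivery. Only the idler can
  -- move, and this gives the update player the first reply.
  start-chain ss₀@(recvS {q} {d = d} {w} eq ◅ ss) h = link 𝕀 (idle-enabled , λ where
      𝕊 c₁ st → let _ , _ , m , _ = sender-step {q , nothing} {wait₀} (messages-valid (d ∷ w)) st in ⊥-elim (waiting-blocked eq m)
      ℝ c₁ st → let _ , _ , m , _ = receiver-step {q , nothing} {wait₀} {messages (d ∷ w)} st in ⊥-elim (idle₀ m)
      𝕀 c₁ st → inj₂ (cong response (idler-step {q , nothing} {wait₀} {messages (d ∷ w)} st)))
    (run-chain ss₀ h)
    where
    idle-enabled : ProcEnabled (represent (q , d ∷ w)) 𝕀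
    idle-enabled = (zero , skip , zero) , here refl , refl , tt

  halting-loses : ∀ {c q w} → c ⟶* (q , w) → act q ≡ halt → ¬ AWins (W-SP haltSet) (A , represent c)
  halting-loses run h = chain-loses (start-chain run h)

-- Fair scheduling by the process player

module _ {nX nV nI} (prog : Vec (Process nX nV) nI) where
  open TSO prog

  enabled? : ∀ c ι i → Dec (Enabled c ι i)
  enabled? c ι (rd x d) = readVal c ι x Fin.≟ d
  enabled? c ι (wr x d) = yes tt
  enabled? c ι skip     = yes tt
  enabled? c ι mf       with lookup (b c) ι
  ... | []    = yes refl
  ... | _ ∷ _ = no λ ()

  procEnabled? : ∀ c ι → Dec (ProcEnabled c ι)
  procEnabled? c ι = map′ (λ a → find a) (λ (t , mem , ready) → lose mem ready) (any? ready? (δ (lookup prog ι)))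
    where
    Ready : Trans ι → Set
    Ready (q , i , _) = q ≡ plookup (s c) ι × Enabled c ι i
    ready? : ∀ t → Dec (Ready t)
    ready? (q , i , _) = (q Fin.≟ plookup (s c) ι) ×-dec enabled? c ι i

  perform : ∀ {c ι} → ProcEnabled c ι → ∃ (ProcStep c ι)
  perform ((q , i , q′) , mem , q≡ , en) = _ , (q , i , q′) , mem , q≡ , en , refl

module _ {nX nV nI} {prog : Vec (Process nX nV) nI} where

  open TSO prog

  -- The process player lets the idler move in every second turn and otherwise gives hi
  -- priority over lo.  The index n of the invariant bounds the number of moves of hi
  -- before the next move of lo.
  module Scheduled (F : PerProc StateSet prog)
    (hi lo idler : Fin nI)
    (cover    : ∀ ι → ι ≡ hi ⊎ ι ≡ lo ⊎ ι ≡ idler)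
    (idle     : ∀ c → ∃ (ProcStep c idler))
    (Inv      : ℕ → Conf → Set)
    (safe     : ∀ {n c p} → Inv n c → ¬ InCF F (p , c))
    (idling   : ∀ {n c} → Inv n c → proj₁ (idle c) ≡ c)
    (updating : ∀ {n c c′} → Inv n c → Update c c′ →
                Inv n c′ × (ProcEnabled c hi → ProcEnabled c′ hi) × (ProcEnabled c lo → ProcEnabled c′ lo))
    (moveHi   : ∀ {n c c′} → Inv n c → ProcStep c hi c′ →
                (∃ λ m → n ≡ suc m × Inv m c′) × (ProcEnabled c lo → ProcEnabled c′ lo))
    (moveLo   : ∀ {n c c′} → Inv n c → ¬ ProcEnabled c hi → ProcStep c lo c′ → ∃ λ m → Inv m c′)
    where

    -- The process player moves at even times.
    idleTurn : ℕ → Bool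
    idleTurn 0                         = true
    idleTurn 1                         = false
    idleTurn 2                         = false
    idleTurn 3                         = false
    idleTurn (suc (suc (suc (suc n)))) = idleTurn n

    idleTurn-4 : ∀ n → idleTurn (n * 4) ≡ true
    idleTurn-4 zero    = refl
    idleTurn-4 (suc n) = idleTurn-4 n

    idleTurn-alternates : ∀ k → idleTurn k ≡ true → idleTurn (2 + k) ≡ false
    idleTurn-alternates 0 _ = refl
    idleTurn-alternates (suc (suc (suc (suc k)))) eq = idleTurn-alternates k eq

    data Choice (c c′ : Conf) : Bool → Set where
      byHi    : ProcStep c hi c′ → Choice c c′ false
      byLo    : ¬ ProcEnabled c hi → ProcStep c lo c′ → Choice c c′ false
      blocked : ¬ ProcEnabled c hi → ¬ ProcEnabled c lo → c′ ≡ proj₁ (idle c) → Choice c c′ false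
      byIdler : c′ ≡ proj₁ (idle c) → Choice c c′ true

    decide : ∀ b c → ∃ λ c′ → Choice c c′ b
    decide true  c = _ , byIdler refl
    decide false c with procEnabled? prog c hi
    ... | yes en = let _ , st = perform prog en in _ , byHi st
    ... | no ¬hi with procEnabled? prog c lo
    ...   | yes en = let _ , st = perform prog en in _ , byLo ¬hi st
    ...   | no ¬lo = _ , blocked ¬hi ¬lo refl

    choice-step : ∀ {b c c′} → Choice c c′ b → ∃ λ ι → ProcStep c ι c′
    choice-step (byHi st)          = hi , st
    choice-step (byLo _ st)        = lo , st
    choice-step {c = c} (blocked _ _ refl) = idler , proj₂ (idle c)
    choice-step {c = c} (byIdler refl)     = idler , proj₂ (idle c)

    schedule : Strategy
    schedule h (A , c) = B , proj₁ (decide (idleTurn (length h)) c)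
    schedule h (B , c) = B , c

    schedule-legal : Legal A schedule
    schedule-legal h (A , c) _ _ = choice-step (proj₂ (decide (idleTurn (length h)) c))

    inv-updates : ∀ {n c c′} → Inv n c → Star Update c c′ →
                  Inv n c′ × (ProcEnabled c hi → ProcEnabled c′ hi) × (ProcEnabled c lo → ProcEnabled c′ lo)
    inv-updates inv ε        = inv , (λ en → en) , (λ en → en)
    inv-updates inv (u ◅ us) =
      let inv₁ , hi₁ , lo₁ = updating inv u
          inv₂ , hi₂ , lo₂ = inv-updates inv₁ us
      in inv₂ , (λ en → hi₂ (hi₁ en)) , (λ en → lo₂ (lo₁ en))

    inv-choice : ∀ {n c c′ b} → Inv n c → Choice c c′ b → ∃ λ m → Inv m c′
    inv-choice inv (byHi st) = let m , _ , inv′ = proj₁ (moveHi inv st) in m , inv′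
    inv-choice inv (byLo ¬hi st) = moveLo inv ¬hi st
    inv-choice {n} inv (blocked _ _ refl) = n , subst (Inv n) (sym (idling inv)) inv
    inv-choice {n} inv (byIdler refl) = n , subst (Inv n) (sym (idling inv)) inv

    module _ {σB : Strategy} {c₀ n₀} (inv₀ : Inv n₀ c₀) where

      hist-length : ∀ π k → length (hist π k) ≡ k
      hist-length π zero    = refl
      hist-length π (suc k) = cong suc (hist-length π k)

      module _ {π} (outcome : InfOutcome schedule σB (A , c₀) π) where

        conf : ℕ → Conf
        conf k = proj₂ (π k)

        Turn : Player → ℕ → Set
        Turn p k = proj₁ (π k) ≡ p

        process-turn : ∀ k → Turn A k → Turn B (1 + k) × Choice (conf k) (conf (1 + k)) (idleTurn k)
        process-turn k turn with π k | turn | proj₂ (proj₂ outcome) k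
        ... | A , c | refl | eq rewrite hist-length π k =
          cong proj₁ eq , subst (λ c′ → Choice c c′ (idleTurn k)) (sym (cong proj₂ eq)) (proj₂ (decide (idleTurn k) c))

        update-turn : ∀ k → Turn B k → Turn A (1 + k) × Star Update (conf k) (conf (1 + k))
        update-turn k turn with π k | π (suc k) | turn | proj₁ (proj₂ outcome) k
        ... | B , c | A , c′ | refl | us = refl , us

        turns : ∀ k → Turn A k ⊎ Turn B k
        turns zero    = inj₁ (cong proj₁ (proj₁ outcome))
        turns (suc k) with turns k
        ... | inj₁ a = inj₂ (proj₁ (process-turn k a))
        ... | inj₂ b = inj₁ (proj₁ (update-turn k b))

        invariant : ∀ k → ∃ λ n → Inv n (conf k)
        invariant zero    = n₀ , subst (λ g → Inv n₀ (proj₂ g)) (sym (proj₁ outcome)) inv₀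
        invariant (suc k) with invariant k | turns k
        ... | n , inv | inj₁ a = inv-choice inv (proj₂ (process-turn k a))
        ... | n , inv | inj₂ b = n , proj₁ (inv-updates inv (proj₂ (update-turn k b)))

        turn-A : ∀ n → Turn A (n * 2)
        turn-A zero    = cong proj₁ (proj₁ outcome)
        turn-A (suc n) = proj₁ (update-turn _ (proj₁ (process-turn _ (turn-A n))))

        Executes : Fin nI → ℕ → Set
        Executes ι k = Turn A k × ProcStep (conf k) ι (conf (1 + k))

        wait-round : ∀ {n} k → Turn A k → idleTurn k ≡ true → Inv n (conf k) →
          Turn A (2 + k) × idleTurn (2 + k) ≡ false × Inv n (conf (2 + k)) ×
          (ProcEnabled (conf k) hi → ProcEnabled (conf (2 + k)) hi) × (ProcEnabled (conf k) lo → ProcEnabled (conf (2 + k)) lo)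
        wait-round k a idl inv with idleTurn k in eq | process-turn k a
        ... | true | b , byIdler same =
          let a′ , us = update-turn (1 + k) b
          in a′ , idleTurn-alternates k eq , inv-updates inv (subst (λ c → Star Update c (conf (2 + k))) (trans same (idling inv)) us)

        hi-executes : ∀ k → Turn A k → ProcEnabled (conf k) hi → idleTurn k ≡ false → Executes hi k
        hi-executes k a en busy with idleTurn k | process-turn k a
        ... | false | _ , byHi st         = a , st
        ... | false | _ , byLo ¬hi _      = ⊥-elim (¬hi en)
        ... | false | _ , blocked ¬hi _ _ = ⊥-elim (¬hi en)

        hi-fair : ∀ k → Turn A k → ProcEnabled (conf k) hi → ∃ λ k′ → k ≤ k′ × Executes hi k′
        hi-fair k a en with idleTurn k in eq
        ... | false = k , ≤-refl , hi-executes k a en eq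
        ... | true  = let a′ , busy , _ , hi′ , _ = wait-round k a eq (proj₂ (invariant k))
                      in 2 + k , m≤n+m k 2 , hi-executes (2 + k) a′ (hi′ en) busy

        mutual
          -- Each move of `hi` lowers the index, while idling and updates preserve it; throughout,
          -- `lo` stays enabled. So `hi` can delay `lo` at most `n` times.
          lo-fair : ∀ n k → Turn A k → Inv n (conf k) → ProcEnabled (conf k) lo → ∃ λ k′ → k ≤ k′ × Executes lo k′
          lo-fair n k a inv en with idleTurn k in eq
          ... | false = lo-fair-busy n k a inv en eq
          ... | true  = let a′ , busy , inv′ , _ , lo′ = wait-round k a eq inv
                            k′ , le , ex = lo-fair-busy n (2 + k) a′ inv′ (lo′ en) busy
                        in k′ , ≤-trans (m≤n+m k 2) le , ex

          lo-fair-busy : ∀ n k → Turn A k → Inv n (conf k) → ProcEnabled (conf k) lo → idleTurn k ≡ false →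
                         ∃ λ k′ → k ≤ k′ × Executes lo k′
          lo-fair-busy n k a inv en busy with idleTurn k | process-turn k a
          ... | false | _ , byLo _ st       = k , ≤-refl , a , st
          ... | false | _ , blocked _ ¬lo _ = ⊥-elim (¬lo en)
          ... | false | b , byHi st with n | moveHi inv st
          ...   | suc m | (_ , refl , inv₁) , lo₁ =
            let a′ , us = update-turn (1 + k) b
                inv₂ , _ , lo₂ = inv-updates inv₁ us
                k′ , le , ex = lo-fair m (2 + k) a′ inv₂ (lo₂ (lo₁ en))
            in k′ , ≤-trans (m≤n+m k 2) le , ex

        idler-executes : ∀ k → Turn A k → idleTurn k ≡ true → Executes idler k
        idler-executes k a idl with idleTurn k | process-turn k a
        ... | true | _ , byIdler same = a , subst (ProcStep (conf k) idler) (sym same) (proj₂ (idle (conf k)))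

        fair : W-P π
        fair ι often n with cover ι
        ... | inj₁ refl = let k , n≤k , a , en = often n
                              k′ , k≤k′ , ex = hi-fair k a en
                          in k′ , ≤-trans n≤k k≤k′ , ex
        ... | inj₂ (inj₁ refl) = let k , n≤k , a , en = often n
                                     m , inv = invariant k
                                     k′ , k≤k′ , ex = lo-fair m k a inv en
                                 in k′ , ≤-trans n≤k k≤k′ , ex
        ... | inj₂ (inj₂ refl) = n * 4 , m≤m*n n 4 , idler-executes (n * 4) (subst (Turn A) (*-assoc n 2 2) (turn-A (n * 2))) (idleTurn-4 n)

    invariant-wins : ∀ {n c} → Inv n c → AWins (W-SP F) (A , c)
    invariant-wins {c = c₀} inv = schedule , schedule-legal , λ σB _ →
        (λ π out → (λ k → safe {p = proj₁ (π k)} (proj₂ (invariant {σB} inv out k))) , fair {σB} inv out)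
      , (λ n π out → stuck n π (proj₂ (proj₂ (proj₂ out))))
      where
      stuck : ∀ n (π : ℕ → GConf) → ¬ ∃ (Move (π n)) → proj₁ (π n) ≡ B
      stuck n π dead with π n
      ... | A , c = ⊥-elim (dead ((B , proj₁ (idle c)) , idler , proj₂ (idle c)))
      ... | B , c = refl

-- Diverging machines: the process player wins

snoc≢[] : ∀ {A : Set} (xs : List A) {x} → [] ≢ xs ++ [ x ]
snoc≢[] []      ()
snoc≢[] (_ ∷ _) ()

module Running (M : QueueMachine) where
  open QueueMachine M
  open Runs M
  open Game M

  data Phase : Set where
    letterPhase tickPhase : Phase

  -- The part of the invariant about the variable z.  Here q , w is the queue machine
  -- configuration simulated so far, with the letter being handed over still in w during
  -- the tick phase; zp are the pending writes to z, o is the message that the sender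
  -- still has to write to complete its last letter, and the last index bounds the
  -- number of moves of the sender before the next move of the receiver.
  data Handover : Phase → Local → Fin 3 → List Msg → Q → List Letter → List Msg → ℕ → Set where
    main   : ∀ {q w} → Handover letterPhase (q , nothing) zero [] q w [] (pot q)
    owing  : ∀ {q₀ e q w} → act q₀ ≡ send e q → Handover letterPhase (q₀ , just one) zero [] q w [ tick ] (suc (pot q))
    late⁺  : ∀ {q₀ f d w} → act q₀ ≡ recv f → Handover letterPhase (q₀ , just d) (val d) [ 𝐳 , zero ] (f d) w [] (suc (pot (f d)))
    late   : ∀ {q₀ f d w} → act q₀ ≡ recv f → Handover letterPhase (q₀ , just d) zero [] (f d) w [] (suc (pot (f d)))
    ready⁺ : ∀ {q f d w} → act q ≡ recv f → Handover tickPhase (q , nothing) zero [ 𝐳 , val d ] q (d ∷ w) [] 1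
    ready  : ∀ {q f d w} → act q ≡ recv f → Handover tickPhase (q , nothing) (val d) [] q (d ∷ w) [] 1
    taken  : ∀ {q f d w} → act q ≡ recv f → Handover tickPhase (q , just d) (val d) [] q (d ∷ w) [] 0

  -- over means that the update player has delivered too many messages, which the
  -- receiver will notice.  The stream v consists of the messages not yet delivered.
  data Expecting₀ : (x y : Fin 3) → List Msg → List Letter → Set where
    empty : ∀ {w} → Expecting₀ zero zero (messages w) w
    full  : ∀ {d w} → Expecting₀ (val d) zero (messages w ++ [ tick ]) (d ∷ w)
    over  : ∀ {x v w} → Expecting₀ x (suc zero) v w

  data Expecting₁ : (x y : Fin 3) → List Msg → List Letter → Set where
    empty : ∀ {w} → Expecting₁ zero zero (messages w ++ [ tick ]) w
    full  : ∀ {w} → Expecting₁ zero (suc zero) (messages w) w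
    over  : ∀ {d y v w} → Expecting₁ (val d) y v w

  -- `a` is the memory value of the variable being consumed in the good case: the received value
  -- until the reset is updated, and zero from then on.
  data Holding₀ (a : Fin 3) (d : Letter) : (x y : Fin 3) → List Msg → List Letter → Set where
    good : ∀ {w} → Holding₀ a d a zero (messages w ++ [ tick ]) (d ∷ w)
    over : ∀ {x v w} → Holding₀ a d x (suc zero) v w

  data Holding₁ (a : Fin 3) : (x y : Fin 3) → List Msg → List Letter → Set where
    good : ∀ {w} → Holding₁ a zero a (messages w) w
    over : ∀ {d y v w} → Holding₁ a (val d) y v w

  -- The part of the invariant about x₀ and x₁; xp are the pending writes to them.
  data Channel : Phase → Receiver → (x y : Fin 3) → (xp zp v : List Msg) → List Letter → Set where
    wait₀    : ∀ {x y zp v w} → Expecting₀ x y v w → Channel letterPhase wait₀ x y [] zp v w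
    got₀     : ∀ {d x y zp v w} → Holding₀ (val d) d x y v w → Channel letterPhase (got (just d)) x y [] zp v w
    fence₀⁺  : ∀ {d x y zp v w} → Holding₀ (val d) d x y v w → Channel letterPhase (fence (just d)) x y [ x₀ , zero ] zp v w
    -- Pending writes to `z` are older than the reset, so by FIFO none is left once the reset has
    -- reached the memory.
    fence₀   : ∀ {d x y v w} → Holding₀ zero d x y v w → Channel letterPhase (fence (just d)) x y [] [] v w
    check₀   : ∀ {d x y v w} → Holding₀ zero d x y v w → Channel letterPhase (check (just d)) x y [] [] v w
    publish₀ : ∀ {d x y v w} → Expecting₁ x y v w → Channel letterPhase (publish (just d)) x y [] [] v (d ∷ w)
    wait₁    : ∀ {d x y zp v w} → Expecting₁ x y v w → Channel tickPhase wait₁ x y [] zp v (d ∷ w)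
    got₁     : ∀ {d x y zp v w} → Holding₁ (suc zero) x y v w → Channel tickPhase (got nothing) x y [] zp v (d ∷ w)
    fence₁⁺  : ∀ {d x y zp v w} → Holding₁ (suc zero) x y v w → Channel tickPhase (fence nothing) x y [ x₁ , zero ] zp v (d ∷ w)
    fence₁   : ∀ {d x y v w} → Holding₁ zero x y v w → Channel tickPhase (fence nothing) x y [] [] v (d ∷ w)
    check₁   : ∀ {d x y v w} → Holding₁ zero x y v w → Channel tickPhase (check nothing) x y [] [] v (d ∷ w)
    publish₁ : ∀ {d x y v w} → Expecting₀ x y v w → Channel tickPhase (publish nothing) x y [] [] v (d ∷ w)
    -- The receiver has retired, so the undelivered messages `v` no longer have to agree with the
    -- queue `w`.
    won      : ∀ {φ x y zp v w} → Channel φ win x y [] zp v w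

  -- A letter counts as sent as soon as its first message is written. Prepending the owed tick `o`
  -- to the buffer makes up for its missing second half.
  data Invariant (n : ℕ) : Conf → Set where
    invariant : ∀ {φ l r bs x y z xp zp q w o m} → Live (q , w) → Handover φ l z zp q w o m →
      Channel φ r x y xp zp (o ++ bs) w → All FromSender bs → m ≤ n →
      Invariant n (conf l r bs (xp ++ zp) x y z)

  cell₀ cell₁ : Msg → Fin 3 → Fin 3
  cell₀ (x₀ , d) x = d
  cell₀ _        x = x
  cell₁ (x₁ , d) y = d
  cell₁ _        y = y

  messages-pop : ∀ {v m} w → messages w ≡ v ++ [ m ] →
    Σ Letter λ d → Σ (List Letter) λ w′ → w ≡ d ∷ w′ × m ≡ (x₀ , val d) × v ≡ messages w′ ++ [ tick ]
  messages-pop {v} []      eq = ⊥-elim (snoc≢[] v eq)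
  messages-pop {v} (d ∷ w) eq = let eq₁ , eq₂ = ∷ʳ-injective _ v eq in d , w , refl , sym eq₂ , sym eq₁

  tick-pop : ∀ {v m} w → messages w ++ [ tick ] ≡ v ++ [ m ] → m ≡ tick × v ≡ messages w
  tick-pop {v} w eq = let eq₁ , eq₂ = ∷ʳ-injective _ v eq in sym eq₂ , sym eq₁

  -- The first delivery fills the awaited variable. A second one concerns the other variable and
  -- gives `over`, which no later delivery can undo, because the sender writes nonzero values only.
  pop-expecting₀ : ∀ {x y u v w m} → FromSender m → u ≡ v ++ [ m ] → Expecting₀ x y u w →
    Expecting₀ (cell₀ m x) (cell₁ m y) v w
  pop-expecting₀ fs eq (empty {w}) with _ , _ , refl , refl , refl ← messages-pop w eq = full
  pop-expecting₀ fs eq (full {w = w}) with refl , refl ← tick-pop w eq = over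
  pop-expecting₀ (letterᵐ d) eq over = over
  pop-expecting₀ tickᵐ       eq over = over

  pop-expecting₁ : ∀ {x y u v w m} → FromSender m → u ≡ v ++ [ m ] → Expecting₁ x y u w →
    Expecting₁ (cell₀ m x) (cell₁ m y) v w
  pop-expecting₁ fs eq (empty {w}) with refl , refl ← tick-pop w eq = full
  pop-expecting₁ fs eq (full {w}) with _ , _ , refl , refl , refl ← messages-pop w eq = over
  pop-expecting₁ (letterᵐ d) eq over = over
  pop-expecting₁ tickᵐ       eq over = over

  pop-holding₀ : ∀ {a d x y u v w m} → FromSender m → u ≡ v ++ [ m ] → Holding₀ a d x y u w →
    Holding₀ a d (cell₀ m x) (cell₁ m y) v w
  pop-holding₀ fs eq (good {w}) with refl , refl ← tick-pop w eq = over
  pop-holding₀ (letterᵐ d) eq over = over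
  pop-holding₀ tickᵐ       eq over = over

  pop-holding₁ : ∀ {a x y u v w m} → FromSender m → u ≡ v ++ [ m ] → Holding₁ a x y u w →
    Holding₁ a (cell₀ m x) (cell₁ m y) v w
  pop-holding₁ fs eq (good {w}) with _ , _ , refl , refl , refl ← messages-pop w eq = over
  pop-holding₁ (letterᵐ d) eq over = over
  pop-holding₁ tickᵐ       eq over = over

  pop-channel : ∀ {φ r x y xp zp u v w m} → FromSender m → u ≡ v ++ [ m ] → Channel φ r x y xp zp u w →
    Channel φ r (cell₀ m x) (cell₁ m y) xp zp v w
  pop-channel fs eq (wait₀ h)    = wait₀ (pop-expecting₀ fs eq h)
  pop-channel fs eq (got₀ h)     = got₀ (pop-holding₀ fs eq h)
  pop-channel fs eq (fence₀⁺ h)  = fence₀⁺ (pop-holding₀ fs eq h)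
  pop-channel fs eq (fence₀ h)   = fence₀ (pop-holding₀ fs eq h)
  pop-channel fs eq (check₀ h)   = check₀ (pop-holding₀ fs eq h)
  pop-channel fs eq (publish₀ h) = publish₀ (pop-expecting₁ fs eq h)
  pop-channel fs eq (wait₁ h)    = wait₁ (pop-expecting₁ fs eq h)
  pop-channel fs eq (got₁ h)     = got₁ (pop-holding₁ fs eq h)
  pop-channel fs eq (fence₁⁺ h)  = fence₁⁺ (pop-holding₁ fs eq h)
  pop-channel fs eq (fence₁ h)   = fence₁ (pop-holding₁ fs eq h)
  pop-channel fs eq (check₁ h)   = check₁ (pop-holding₁ fs eq h)
  pop-channel fs eq (publish₁ h) = publish₁ (pop-expecting₀ fs eq h)
  pop-channel fs eq won          = won

  extend : Letter → List Msg → List Msg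
  extend e v = tick ∷ (x₀ , val e) ∷ v

  push-expecting₀ : ∀ {x y v w} e → Expecting₀ x y v w → Expecting₀ x y (extend e v) (w ++ [ e ])
  push-expecting₀ e (empty {w})        = subst (λ v → Expecting₀ zero zero v (w ++ [ e ])) (messages-snoc w e) empty
  push-expecting₀ e (full {d} {w}) = subst (λ v → Expecting₀ (val d) zero v (d ∷ w ++ [ e ])) (cong (_++ [ tick ]) (messages-snoc w e)) full
  push-expecting₀ e over           = over

  push-expecting₁ : ∀ {x y v w} e → Expecting₁ x y v w → Expecting₁ x y (extend e v) (w ++ [ e ])
  push-expecting₁ e (empty {w}) = subst (λ v → Expecting₁ zero zero v (w ++ [ e ])) (cong (_++ [ tick ]) (messages-snoc w e)) empty
  push-expecting₁ e (full {w})  = subst (λ v → Expecting₁ zero (suc zero) v (w ++ [ e ])) (messages-snoc w e) full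
  push-expecting₁ e over        = over

  push-holding₀ : ∀ {a d x y v w} e → Holding₀ a d x y v w → Holding₀ a d x y (extend e v) (w ++ [ e ])
  push-holding₀ {a} {d} e (good {w}) = subst (λ v → Holding₀ a d a zero v (d ∷ w ++ [ e ])) (cong (_++ [ tick ]) (messages-snoc w e)) good
  push-holding₀ e over       = over

  -- The letter phase suffices, since in the tick phase the sender is in the middle of a receive.
  push-channel : ∀ {r x y xp zp v w} e → Channel letterPhase r x y xp zp v w →
    Channel letterPhase r x y xp zp (extend e v) (w ++ [ e ])
  push-channel e (wait₀ h)    = wait₀ (push-expecting₀ e h)
  push-channel e (got₀ h)     = got₀ (push-holding₀ e h)
  push-channel e (fence₀⁺ h)  = fence₀⁺ (push-holding₀ e h)
  push-channel e (fence₀ h)   = fence₀ (push-holding₀ e h)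
  push-channel e (check₀ h)   = check₀ (push-holding₀ e h)
  push-channel e (publish₀ h) = publish₀ (push-expecting₁ e h)
  push-channel e won          = won

  pot-room : ∀ {a b n} → 2 + a ≤ b → b ≤ n → ∃ λ m → n ≡ suc m × suc a ≤ m
  pot-room p q with ≤-trans p q
  ... | s≤s r = _ , refl , r

  suc-room : ∀ {a n} → suc a ≤ n → ∃ λ m → n ≡ suc m × a ≤ m
  suc-room (s≤s r) = _ , refl , r

  sender-moves : ∀ {n φ l r bs x y z xp zp q w o m l′ bs′} → Live (q , w) → Handover φ l z zp q w o m →
    Channel φ r x y xp zp (o ++ bs) w → All FromSender bs → m ≤ n → SMove l z bs l′ bs′ →
    ∃ λ n′ → n ≡ suc n′ × Invariant n′ (conf l′ r bs′ (xp ++ zp) x y z)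
  sender-moves live main ch ms le (take _ d eq) = ⊥-elim (val≢0 (sym eq))
  sender-moves live main ch ms le (put {e = e} eq) =
    let n′ , eq′ , le′ = pot-room (pot-send eq) le
    in n′ , eq′ , invariant (live-step live (sendS eq)) (owing eq) (push-channel e ch) (letterᵐ e ∷ ms) le′
  sender-moves live (owing eq) ch ms le (tock eq₁) with refl ← trans (sym eq) eq₁ =
    let n′ , eq′ , le′ = suc-room le in n′ , eq′ , invariant live main ch (tickᵐ ∷ ms) le′
  sender-moves live (owing eq) ch ms le (done eq₁ _) with () ← trans (sym eq) eq₁
  sender-moves live (late⁺ eq) ch ms le (done _ eq₁) = ⊥-elim (val≢0 eq₁)
  sender-moves live (late⁺ eq) ch ms le (tock eq₁) with () ← trans (sym eq) eq₁
  sender-moves live (late eq) ch ms le (done eq₁ _) with refl ← trans (sym eq) eq₁ =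
    let n′ , eq′ , le′ = suc-room le in n′ , eq′ , invariant live main ch ms le′
  sender-moves live (late eq) ch ms le (tock eq₁) with () ← trans (sym eq) eq₁
  sender-moves live (ready⁺ eq) ch ms le (take _ d eq₁) = ⊥-elim (val≢0 (sym eq₁))
  sender-moves live (ready⁺ eq) ch ms le (put eq₁) with () ← trans (sym eq) eq₁
  sender-moves live (ready eq) ch ms le (take _ d eq₁) with refl ← val-injective eq₁ =
    let n′ , eq′ , le′ = suc-room le in n′ , eq′ , invariant live (taken eq) ch ms le′
  sender-moves live (ready eq) ch ms le (put eq₁) with () ← trans (sym eq) eq₁
  sender-moves live (taken eq) ch ms le (done _ eq₁) = ⊥-elim (val≢0 eq₁)
  sender-moves live (taken eq) ch ms le (tock eq₁) with () ← trans (sym eq) eq₁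

  Transparent : List Msg → Set
  Transparent br = ∀ v → seen x₀ v br ≡ v × seen x₁ v br ≡ v

  handover-transparent : ∀ {φ l z zp q w o m} → Handover φ l z zp q w o m → Transparent zp
  handover-transparent main       v = refl , refl
  handover-transparent (owing _)  v = refl , refl
  handover-transparent (late⁺ _)  v = refl , refl
  handover-transparent (late _)   v = refl , refl
  handover-transparent (ready⁺ _) v = refl , refl
  handover-transparent (ready _)  v = refl , refl
  handover-transparent (taken _)  v = refl , refl

  channel-clear : ∀ {φ r x y xp zp v w r′ br′} → Channel φ r x y xp zp v w → RMove x y (xp ++ zp) r r′ br′ → xp ≡ []
  channel-clear (fence₀⁺ _)  (fenced ())
  channel-clear (fence₁⁺ _)  (fenced ())
  channel-clear (wait₀ _)    _ = refl
  channel-clear (got₀ _)     _ = refl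
  channel-clear (fence₀ _)   _ = refl
  channel-clear (check₀ _)   _ = refl
  channel-clear (publish₀ _) _ = refl
  channel-clear (wait₁ _)    _ = refl
  channel-clear (got₁ _)     _ = refl
  channel-clear (fence₁ _)   _ = refl
  channel-clear (check₁ _)   _ = refl
  channel-clear (publish₁ _) _ = refl
  channel-clear won          _ = refl

  -- Excess deliveries are noticed in the `check` states: passing the test contradicts `over`, so
  -- the simulation continues only from the good case.
  channel-moves : ∀ {φ r x y zp v w r′ br′} → Transparent zp → Channel φ r x y [] zp v w → RMove x y zp r r′ br′ →
    (∀ p → r ≢ publish p) → Σ (List Msg) λ xp′ → br′ ≡ xp′ ++ zp × Channel φ r′ x y xp′ zp v w
  channel-moves {x = x} tr (wait₀ h) (receive₀ d eq) _ = [] , refl , got₀ (held h (trans (sym (proj₁ (tr x))) eq))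
    where
    held : ∀ {x y v w} → Expecting₀ x y v w → x ≡ val d → Holding₀ (val d) d x y v w
    held empty eq = ⊥-elim (val≢0 (sym eq))
    held full  eq with refl ← val-injective eq = good
    held over  eq = over
  channel-moves tr (wait₀ h) (win₀ _) _ = [] , refl , won
  channel-moves tr (got₀ h) reset₀ _ = [ x₀ , zero ] , refl , fence₀⁺ h
  channel-moves tr (fence₀ h) (fenced _) _ = [] , refl , check₀ h
  channel-moves {y = y} tr (check₀ good) (pass₀ _) _ = [] , refl , publish₀ empty
  channel-moves {y = y} tr (check₀ over) (pass₀ ()) _
  channel-moves tr (check₀ h) (caught₀ _) _ = [] , refl , won
  channel-moves tr (publish₀ h) publish₀ ne = ⊥-elim (ne _ refl)
  channel-moves {y = y} tr (wait₁ h) (receive₁ eq) _ = [] , refl , got₁ (held h (trans (sym (proj₂ (tr y))) eq))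
    where
    held : ∀ {x y v w} → Expecting₁ x y v w → y ≡ suc zero → Holding₁ (suc zero) x y v w
    held full  eq = good
    held over  eq = over
  channel-moves tr (wait₁ h) (win₁ _ _) _ = [] , refl , won
  channel-moves tr (got₁ h) reset₁ _ = [ x₁ , zero ] , refl , fence₁⁺ h
  channel-moves tr (fence₁ h) (fenced _) _ = [] , refl , check₁ h
  channel-moves tr (check₁ good) (pass₁ _) _ = [] , refl , publish₁ empty
  channel-moves tr (check₁ over) (pass₁ eq) _ = ⊥-elim (val≢0 eq)
  channel-moves tr (check₁ h) (caught₁ _ _) _ = [] , refl , won
  channel-moves tr (publish₁ h) publish₁ ne = ⊥-elim (ne _ refl)

  -- Here the priority of the sender is used. A blocked sender is waiting for a letter in the letter
  -- phase, as a live machine has not halted, and has already taken it in the tick phase. Hence no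
  -- value of `z` is overwritten unread.
  publish-moves : ∀ {n φ l p bs x y z zp q w o m r′ br′} → Live (q , w) → Handover φ l z zp q w o m →
    Channel φ (publish p) x y [] zp (o ++ bs) w → All FromSender bs → m ≤ n →
    ¬ ProcEnabled (conf l (publish p) bs zp x y z) 𝕊 →
    RMove x y zp (publish p) r′ br′ → ∃ λ n′ → Invariant n′ (conf l r′ bs br′ x y z)
  publish-moves {l = q , _} live main (publish₀ {d} h) ms le ¬en publish₀ with act q in eq
  ... | halt      = ⊥-elim (live-¬halt live eq)
  ... | recv f    = 1 , invariant live (ready⁺ eq) (wait₁ h) ms ≤-refl
  ... | send e q′ = ⊥-elim (¬en (sender-enabled {q , nothing} {publish (just d)} ms (put eq)))
  publish-moves live (owing eq) (publish₀ {d} h) ms le ¬en publish₀ =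
    ⊥-elim (¬en (sender-enabled {r = publish (just d)} ms (tock eq)))
  publish-moves live (late eq) (publish₀ {d} h) ms le ¬en publish₀ =
    ⊥-elim (¬en (sender-enabled {r = publish (just d)} ms (done eq refl)))
  publish-moves live (ready {d = d} eq) (publish₁ h) ms le ¬en publish₁ =
    ⊥-elim (¬en (sender-enabled {r = publish nothing} ms (take eq d refl)))
  publish-moves live (taken eq) (publish₁ h) ms le ¬en publish₁ =
    _ , invariant (live-step live (recvS eq)) (late⁺ eq) (wait₀ h) ms ≤-refl

  publishing? : ∀ r → (∃ λ p → r ≡ publish p) ⊎ (∀ p → r ≢ publish p)
  publishing? (publish p) = inj₁ (p , refl)
  publishing? win         = inj₂ λ _ ()
  publishing? wait₀       = inj₂ λ _ ()
  publishing? wait₁       = inj₂ λ _ ()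
  publishing? (got _)     = inj₂ λ _ ()
  publishing? (fence _)   = inj₂ λ _ ()
  publishing? (check _)   = inj₂ λ _ ()

  receiver-moves : ∀ {n φ l r bs x y z xp zp q w o m r′ br′} → Live (q , w) → Handover φ l z zp q w o m →
    Channel φ r x y xp zp (o ++ bs) w → All FromSender bs → m ≤ n → ¬ ProcEnabled (conf l r bs (xp ++ zp) x y z) 𝕊 →
    RMove x y (xp ++ zp) r r′ br′ → ∃ λ n′ → Invariant n′ (conf l r′ bs br′ x y z)
  receiver-moves {n} {r = r} live ho ch ms le ¬en mv with refl ← channel-clear ch mv | publishing? r
  ... | inj₁ (p , refl) = publish-moves live ho ch ms le ¬en mv
  ... | inj₂ ne with channel-moves (handover-transparent ho) ch mv ne
  ...   | xp′ , refl , ch′ = n , invariant live ho ch′ ms le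

  -- A delivery may falsify the test behind a move, but then it opens another branch of the same
  -- state: a tick turns `pass₀` into `caught₀`, a letter turns `pass₁` into `caught₁`. For fair
  -- scheduling it matters only that some move remains.
  pop-receiver : ∀ {x y zp r r′ br′ m} → Transparent zp → FromSender m → RMove x y zp r r′ br′ →
    ∃ λ r″ → ∃ λ br″ → RMove (cell₀ m x) (cell₁ m y) zp r r″ br″
  pop-receiver {x} {y} tr (letterᵐ e) mv = go mv
    where
    go : ∀ {r r′ br′} → RMove x y _ r r′ br′ → ∃ λ r″ → ∃ λ br″ → RMove (val e) y _ r r″ br″
    go (receive₀ _ _) = _ , _ , receive₀ e (proj₁ (tr _))
    go (win₀ eq)      = _ , _ , win₀ eq
    go reset₀         = _ , _ , reset₀
    go (fenced eq)    = _ , _ , fenced eq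
    go (pass₀ eq)     = _ , _ , pass₀ eq
    go (caught₀ eq)   = _ , _ , caught₀ eq
    go publish₀       = _ , _ , publish₀
    go (receive₁ eq)  = _ , _ , receive₁ eq
    go (win₁ _ _)     = _ , _ , win₁ e (proj₁ (tr _))
    go reset₁         = _ , _ , reset₁
    go (pass₁ _)      = _ , _ , caught₁ e (proj₁ (tr _))
    go (caught₁ _ _)  = _ , _ , caught₁ e (proj₁ (tr _))
    go publish₁       = _ , _ , publish₁
  pop-receiver {x} {y} tr tickᵐ mv = go mv
    where
    go : ∀ {r r′ br′} → RMove x y _ r r′ br′ → ∃ λ r″ → ∃ λ br″ → RMove x (suc zero) _ r r″ br″
    go (receive₀ d eq) = _ , _ , receive₀ d eq
    go (win₀ _)        = _ , _ , win₀ (proj₂ (tr _))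
    go reset₀          = _ , _ , reset₀
    go (fenced eq)     = _ , _ , fenced eq
    go (pass₀ _)       = _ , _ , caught₀ (proj₂ (tr _))
    go (caught₀ _)     = _ , _ , caught₀ (proj₂ (tr _))
    go publish₀        = _ , _ , publish₀
    go (receive₁ _)    = _ , _ , receive₁ (proj₂ (tr _))
    go (win₁ d eq)     = _ , _ , win₁ d eq
    go reset₁          = _ , _ , reset₁
    go (pass₁ eq)      = _ , _ , pass₁ eq
    go (caught₁ d eq)  = _ , _ , caught₁ d eq
    go publish₁        = _ , _ , publish₁

  pop-clear : ∀ {x y xp zp r r′ br′ m} → Transparent zp → FromSender m → RMove x y (xp ++ zp) r r′ br′ → xp ≡ [] →
    ∃ λ r″ → ∃ λ br″ → RMove (cell₀ m x) (cell₁ m y) (xp ++ zp) r r″ br″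
  pop-clear tr fs mv refl = pop-receiver tr fs mv

  sender-buffer-irrelevant : ∀ {l z bs l′ bs′} bs₁ → SMove l z bs l′ bs′ → ∃ λ bs₂ → SMove l z bs₁ l′ bs₂
  sender-buffer-irrelevant _ (take eq d z≡) = _ , take eq d z≡
  sender-buffer-irrelevant _ (done eq z≡)   = _ , done eq z≡
  sender-buffer-irrelevant _ (put eq)       = _ , put eq
  sender-buffer-irrelevant _ (tock eq)      = _ , tock eq

  Persists : Conf → Conf → Set
  Persists c c′ = (ProcEnabled c 𝕊 → ProcEnabled c′ 𝕊) × (ProcEnabled c ℝ → ProcEnabled c′ ℝ)

  sender-persists : ∀ {l r r′ bs bs′ br br′ x x′ y y′ z} → All FromSender bs → All FromSender bs′ →
    ProcEnabled (conf l r bs br x y z) 𝕊 → ProcEnabled (conf l r′ bs′ br′ x′ y′ z) 𝕊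
  sender-persists {l} {r} {r′} {bs′ = bs′} ms ms′ en =
    let _ , _ , mv , _ = sender-step {l} {r} ms (proj₂ (perform program en))
    in sender-enabled {l} {r′} ms′ (proj₂ (sender-buffer-irrelevant bs′ mv))

  receiver-persists : ∀ {l l′ r bs bs′ br br₁ x x₁′ y y₁ z z₁} →
    (∀ {r′ br′} → RMove x y br r r′ br′ → ∃ λ r″ → ∃ λ br″ → RMove x₁′ y₁ br₁ r r″ br″) →
    ProcEnabled (conf l r bs br x y z) ℝ → ProcEnabled (conf l′ r bs′ br₁ x₁′ y₁ z₁) ℝ
  receiver-persists {l} {l′} {r} {bs} {bs′} f en =
    let _ , _ , mv , _ = receiver-step {l} {r} {bs} (proj₂ (perform program en))
    in receiver-enabled {l′} {r} {bs′} (proj₂ (proj₂ (f mv)))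

  deliver : ∀ {n φ l r bs′ x y z xp zp q w o m u} → Live (q , w) → Handover φ l z zp q w o m →
    Channel φ r x y xp zp (o ++ bs′ ++ [ u ]) w → FromSender u → All FromSender (bs′ ++ [ u ]) → All FromSender bs′ → m ≤ n →
    let c′ = conf l r bs′ (xp ++ zp) (cell₀ u x) (cell₁ u y) z in
    Invariant n c′ × Persists (conf l r (bs′ ++ [ u ]) (xp ++ zp) x y z) c′
  deliver {l = l} {r} {bs′} {o = o} live ho ch fs ms ms′ le =
      invariant live ho (pop-channel fs (sym (++-assoc o bs′ _)) ch) ms′ le
    , sender-persists {l} {r} {r} ms ms′
    , receiver-persists {l} {l} {r} (λ mv → pop-clear (handover-transparent ho) fs mv (channel-clear ch mv))

  -- A pending write to `z` is always the one that the sender awaits. So the only kind of update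
  -- that changes what the sender reads enables the sender.
  data PendingZ (φ : Phase) (l : Local) (q : Q) (w : List Letter) (o : List Msg) (m : ℕ) : List Msg → Set where
    none    : PendingZ φ l q w o m []
    pending : ∀ v → Handover φ l v [] q w o m → (∀ bs → ∃ λ l′ → ∃ λ bs′ → SMove l v bs l′ bs′) → PendingZ φ l q w o m [ 𝐳 , v ]

  pendingZ : ∀ {φ l z zp q w o m} → Handover φ l z zp q w o m → PendingZ φ l q w o m zp
  pendingZ main        = none
  pendingZ (owing _)   = none
  pendingZ (late⁺ eq)  = pending _ (late eq) (λ _ → _ , _ , done eq refl)
  pendingZ (late _)    = none
  pendingZ (ready⁺ eq) = pending _ (ready eq) (λ _ → _ , _ , take eq _ refl)
  pendingZ (ready _)   = none
  pendingZ (taken _)   = none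

  publish-channel : ∀ {φ r x y xp zp v w} → Channel φ r x y xp zp v w → Channel φ r x y xp [] v w
  publish-channel (wait₀ h)    = wait₀ h
  publish-channel (got₀ h)     = got₀ h
  publish-channel (fence₀⁺ h)  = fence₀⁺ h
  publish-channel (fence₀ h)   = fence₀ h
  publish-channel (check₀ h)   = check₀ h
  publish-channel (publish₀ h) = publish₀ h
  publish-channel (wait₁ h)    = wait₁ h
  publish-channel (got₁ h)     = got₁ h
  publish-channel (fence₁⁺ h)  = fence₁⁺ h
  publish-channel (fence₁ h)   = fence₁ h
  publish-channel (check₁ h)   = check₁ h
  publish-channel (publish₁ h) = publish₁ h
  publish-channel won          = won

  publish-receiver : ∀ {x y v r r′ br′} → RMove x y [ 𝐳 , v ] r r′ br′ → ∃ λ r″ → ∃ λ br″ → RMove x y [] r r″ br″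
  publish-receiver (receive₀ d eq) = _ , _ , receive₀ d eq
  publish-receiver (win₀ eq)       = _ , _ , win₀ eq
  publish-receiver reset₀          = _ , _ , reset₀
  publish-receiver (pass₀ eq)      = _ , _ , pass₀ eq
  publish-receiver (caught₀ eq)    = _ , _ , caught₀ eq
  publish-receiver publish₀        = _ , _ , publish₀
  publish-receiver (receive₁ eq)   = _ , _ , receive₁ eq
  publish-receiver (win₁ d eq)     = _ , _ , win₁ d eq
  publish-receiver reset₁          = _ , _ , reset₁
  publish-receiver (pass₁ eq)      = _ , _ , pass₁ eq
  publish-receiver (caught₁ d eq)  = _ , _ , caught₁ d eq
  publish-receiver publish₁        = _ , _ , publish₁

  publish-z : ∀ {n φ l r bs x y z xp v q w o m} → Live (q , w) → Handover φ l v [] q w o m →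
    (∀ bs → ∃ λ l′ → ∃ λ bs′ → SMove l v bs l′ bs′) →
    Channel φ r x y xp [ 𝐳 , v ] (o ++ bs) w → All FromSender bs → m ≤ n →
    Invariant n (conf l r bs xp x y v) × Persists (conf l r bs (xp ++ [ 𝐳 , v ]) x y z) (conf l r bs xp x y v)
  publish-z {n} {l = l} {r} {bs} {x} {y} {xp = xp} {v} live ho moves ch ms le =
      subst (λ br → Invariant n (conf l r bs br x y v)) (++-identityʳ xp) (invariant live ho (publish-channel ch) ms le)
    , (λ _ → sender-enabled {l} {r} ms (proj₂ (proj₂ (moves bs))))
    , receiver-persists {l} {l} {r} (λ mv → unblocked mv (channel-clear ch mv))
    where
    unblocked : ∀ {xp r′ br′} → RMove x y (xp ++ [ 𝐳 , v ]) r r′ br′ → xp ≡ [] → ∃ λ r″ → ∃ λ br″ → RMove x y xp r r″ br″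
    unblocked mv refl = publish-receiver mv

  reset-x : ∀ {n φ l r bs x y z xp q w o m} bs′ u d → Live (q , w) → Handover φ l z [] q w o m →
    Channel φ r x y xp [] (o ++ bs) w → All FromSender bs → m ≤ n → xp ++ [] ≡ bs′ ++ [ u , d ] →
    let c  = conf l r bs (xp ++ []) x y z
        c′ = ⟨ s c , bs ∷ bs′ ∷ [] ∷ [] , (x ∷ y ∷ z ∷ []) [ u ]≔ d ⟩ in
    Invariant n c′ × Persists c c′
  reset-x [] u d live ho (fence₀⁺ {d′} h) ms le refl =
      invariant live ho (fence₀ (cleared h)) ms le
    , sender-persists {r = fence (just d′)} {fence (just d′)} ms ms
    , receiver-persists {r = fence (just d′)} (λ { (fenced ()) })
    where
    -- The trace of an excess delivery is on the other variable, out of reach of the reset.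
    cleared : ∀ {a e x y v w} → Holding₀ a e x y v w → Holding₀ zero e zero y v w
    cleared good = good
    cleared over = over
  reset-x [] u d live ho (fence₁⁺ h) ms le refl =
      invariant live ho (fence₁ (cleared h)) ms le
    , sender-persists {r = fence nothing} {fence nothing} ms ms
    , receiver-persists {r = fence nothing} (λ { (fenced ()) })
    where
    cleared : ∀ {a x y v w} → Holding₁ a x y v w → Holding₁ zero x zero v w
    cleared good = good
    cleared over = over
  reset-x (_ ∷ bs′) u d live ho (fence₀⁺ h)  ms le eq = ⊥-elim (snoc≢[] bs′ (∷-injectiveʳ eq))
  reset-x (_ ∷ bs′) u d live ho (fence₁⁺ h)  ms le eq = ⊥-elim (snoc≢[] bs′ (∷-injectiveʳ eq))
  reset-x bs′ u d live ho (wait₀ h)    ms le eq = ⊥-elim (snoc≢[] bs′ eq)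
  reset-x bs′ u d live ho (got₀ h)     ms le eq = ⊥-elim (snoc≢[] bs′ eq)
  reset-x bs′ u d live ho (fence₀ h)   ms le eq = ⊥-elim (snoc≢[] bs′ eq)
  reset-x bs′ u d live ho (check₀ h)   ms le eq = ⊥-elim (snoc≢[] bs′ eq)
  reset-x bs′ u d live ho (publish₀ h) ms le eq = ⊥-elim (snoc≢[] bs′ eq)
  reset-x bs′ u d live ho (wait₁ h)    ms le eq = ⊥-elim (snoc≢[] bs′ eq)
  reset-x bs′ u d live ho (got₁ h)     ms le eq = ⊥-elim (snoc≢[] bs′ eq)
  reset-x bs′ u d live ho (fence₁ h)   ms le eq = ⊥-elim (snoc≢[] bs′ eq)
  reset-x bs′ u d live ho (check₁ h)   ms le eq = ⊥-elim (snoc≢[] bs′ eq)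
  reset-x bs′ u d live ho (publish₁ h) ms le eq = ⊥-elim (snoc≢[] bs′ eq)
  reset-x bs′ u d live ho won          ms le eq = ⊥-elim (snoc≢[] bs′ eq)

  updating : ∀ {n c c′} → Invariant n c → Update c c′ → Invariant n c′ × Persists c c′
  updating (invariant live ho ch ms le) (𝕊 , bs′ , u , d , refl , refl) with All.++⁻ʳ bs′ ms
  ... | letterᵐ e ∷ [] = deliver live ho ch (letterᵐ e) ms (All.++⁻ˡ bs′ ms) le
  ... | tickᵐ ∷ []     = deliver live ho ch tickᵐ ms (All.++⁻ˡ bs′ ms) le
  updating (invariant {xp = xp} live ho ch ms le) (ℝ , bs′ , u , d , eq , refl) with pendingZ ho
  ... | none = reset-x bs′ u d live ho ch ms le eq
  ... | pending v ho′ moves with refl , refl ← ∷ʳ-injective xp bs′ eq = publish-z live ho′ moves ch ms le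
  updating (invariant live ho ch ms le) (𝕀 , bs′ , u , d , eq , _) = ⊥-elim (snoc≢[] bs′ eq)

  moveSender : ∀ {n c c′} → Invariant n c → ProcStep c 𝕊 c′ →
    (∃ λ m → n ≡ suc m × Invariant m c′) × (ProcEnabled c ℝ → ProcEnabled c′ ℝ)
  moveSender {n} (invariant {l = l} {r} {xp = xp} {zp} live ho ch ms le) st with sender-step {l} {r} {br = xp ++ zp} ms st
  ... | l′ , bs′ , mv , refl = sender-moves live ho ch ms le mv
                             , receiver-persists {l} {l′} {r} {bs′ = bs′} (λ mv → _ , _ , mv)

  moveReceiver : ∀ {n c c′} → Invariant n c → ¬ ProcEnabled c 𝕊 → ProcStep c ℝ c′ → ∃ λ m → Invariant m c′
  moveReceiver (invariant {l = l} {r} {bs} live ho ch ms le) ¬en st with receiver-step {l} {r} {bs} st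
  ... | r′ , br′ , mv , refl = receiver-moves live ho ch ms le ¬en mv

  handover-¬halt : ∀ {φ l z zp q w o m} → Live (q , w) → Handover φ l z zp q w o m → isHalt (act (proj₁ l)) ≢ true
  handover-¬halt {l = q , _} live main h with act q in eq
  ... | halt = ⊥-elim (live-¬halt live eq)
  handover-¬halt live (owing eq)  h rewrite eq with () ← h
  handover-¬halt live (late⁺ eq)  h rewrite eq with () ← h
  handover-¬halt live (late eq)   h rewrite eq with () ← h
  handover-¬halt live (ready⁺ eq) h rewrite eq with () ← h
  handover-¬halt live (ready eq)  h rewrite eq with () ← h
  handover-¬halt live (taken eq)  h rewrite eq with () ← h

  safe : ∀ {n c p} → Invariant n c → ¬ InCF haltSet (p , c)
  safe (invariant {l = l} live ho _ _ _) (𝕊 , h) = handover-¬halt live ho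
    (trans (sym (trans (lookup∘tabulate _ (to local-finite l)) (cong (λ l → isHalt (act (proj₁ l))) (from-to local-finite l)))) h)
  safe (invariant {r = r} _ _ _ _ _) (ℝ , h) with () ← trans (sym h) (lookup-replicate (to receiver-finite r) false)
  safe (invariant _ _ _ _ _) (𝕀 , ())

  cover : ∀ (ι : Fin 3) → ι ≡ 𝕊 ⊎ ι ≡ ℝ ⊎ ι ≡ 𝕀
  cover 𝕊 = inj₁ refl
  cover ℝ = inj₂ (inj₁ refl)
  cover 𝕀 = inj₂ (inj₂ refl)

  idling : ∀ {n c} → Invariant n c → exec c 𝕀 skip zero ≡ c
  idling (invariant _ _ _ _ _) = refl

  running-wins : ∀ {q w} → Live (q , w) → AWins (W-SP haltSet) (A , represent (q , w))
  running-wins {w = w} live = Scheduled.invariant-wins haltSet 𝕊 ℝ 𝕀 cover (λ c → _ , idle c) Invariant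
    (λ {n} {c} {p} → safe {n} {c} {p}) idling updating moveSender moveReceiver
    (invariant live main (wait₀ empty) (messages-valid w) ≤-refl)

-- Diagonalisation

encMsg : ∀ {m n} → Fin m × Fin n → ℕ
encMsg (x , d) = ⟪ toℕ x , toℕ d ⟫

-- The codes are opaque because their values are astronomically large.
opaque
  instanceCode : Instance → ℕ
  instanceCode = encode

  decidable-instanceCode : Decidable SafetyFair →
    Σ (Rec 1) λ f → ∀ I → (f [ instanceCode I ∷ [] ]⇓ 1 × SafetyFair I) ⊎ (f [ instanceCode I ∷ [] ]⇓ 0 × ¬ SafetyFair I)
  decidable-instanceCode dec = dec

  encodeList : List ℕ → ℕ
  encodeList = encList

  processesCode : ∀ {nX nV n} → Vec (Process nX nV) n → ℕ
  processesCode ps = encList (Vec.toList (Vec.map encProcess ps))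

  setsCode : ∀ {nX nV n} {ps : Vec (Process nX nV) n} → PerProc StateSet ps → ℕ
  setsCode F = encList (encPer (λ v → encList (Vec.toList (Vec.map encBool v))) F)

  statesCode : ∀ {nX nV n} {ps : Vec (Process nX nV) n} → PerProc LocalState ps → ℕ
  statesCode s = encList (encPer toℕ s)

  buffersCode : ∀ {nX nV n} → Vec (List (Fin nX × Fin nV)) n → ℕ
  buffersCode b = encList (Vec.toList (Vec.map (λ bs → encList (map encMsg bs)) b))

  memoryCode : ∀ {nX nV} → Vec (Fin nV) nX → ℕ
  memoryCode m = encList (Vec.toList (Vec.map toℕ m))

  processCode : ∀ {nX nV} → Process nX nV → ℕ
  processCode = encProcess

  stateCode : ∀ {n} → Fin n → ℕ
  stateCode = toℕ

  setCode : ∀ {n} → Vec Bool n → ℕ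
  setCode v = encList (Vec.toList (Vec.map encBool v))

  bufferCode : ∀ {m n} → List (Fin m × Fin n) → ℕ
  bufferCode bs = encList (map encMsg bs)

  letterCode : Letter → ℕ → ℕ → ℕ
  letterCode d = push₂ (encMsg {3} {3} tick) (encMsg {3} {3} (x₀ , val d))

  encode-parts : ∀ I → let open Instance I in
    instanceCode I ≡ encodeList (nV ∷ nX ∷ nI ∷ processesCode prog ∷ setsCode F ∷ statesCode (s c₀) ∷ buffersCode (b c₀) ∷ memoryCode (m c₀) ∷ [])
  encode-parts I = refl

  processesCode₃ : ∀ {nX nV} (p q r : Process nX nV) →
    processesCode (p ∷ q ∷ r ∷ []) ≡ encodeList (processCode p ∷ processCode q ∷ processCode r ∷ [])
  processesCode₃ p q r = refl

  setsCode₃ : ∀ {nX nV} {p q r : Process nX nV} (f : StateSet p) (g : StateSet q) (h : StateSet r) →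
    setsCode {ps = p ∷ q ∷ r ∷ []} (f ∷ g ∷ h ∷ []) ≡ encodeList (setCode f ∷ setCode g ∷ setCode h ∷ [])
  setsCode₃ f g h = refl

  statesCode₃ : ∀ {nX nV} {p q r : Process nX nV} (s : LocalState p) (t : LocalState q) (u : LocalState r) →
    statesCode {ps = p ∷ q ∷ r ∷ []} (s ∷ t ∷ u ∷ []) ≡ encodeList (stateCode s ∷ stateCode t ∷ stateCode u ∷ [])
  statesCode₃ s t u = refl

  buffersCode₃ : ∀ {m n} (bs : List (Fin m × Fin n)) → buffersCode (bs ∷ [] ∷ [] ∷ []) ≡ encodeList (bufferCode bs ∷ 0 ∷ 0 ∷ [])
  buffersCode₃ bs = refl

  memoryCode₃ : memoryCode {3} {3} (zero ∷ zero ∷ zero ∷ []) ≡ encodeList (0 ∷ 0 ∷ 0 ∷ [])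
  memoryCode₃ = refl

  listR-code : ∀ {n k} {fs : Vec (Rec n) k} {xs} {ys : Vec ℕ k} → fs [ xs ]⇓* ys →
    listR fs [ xs ]⇓ encodeList (Vec.toList ys)
  listR-code = listR-computes

  letterCode-zero : ∀ d t → letterCode d 0 t ≡ t
  letterCode-zero d t = refl

  letterCode-suc : ∀ d n t → letterCode d 1 (letterCode d n t) ≡ letterCode d (suc n) t
  letterCode-suc d n t = refl

  bufferCode-letter : ∀ d (ms : List Msg) → bufferCode (tick ∷ (x₀ , val d) ∷ ms) ≡ letterCode d 1 (bufferCode ms)
  bufferCode-letter d ms = refl

  letterR : ∀ {n} → Letter → Rec n → Rec n → Rec n
  letterR d m t = comp (push₂R (encMsg {3} {3} tick) (encMsg {3} {3} (x₀ , val d))) (m ∷ t ∷ [])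

  letterR-computes : ∀ {n} d {m t : Rec n} {xs a b} → m [ xs ]⇓ a → t [ xs ]⇓ b → letterR d m t [ xs ]⇓ letterCode d a b
  letterR-computes d em et = ev-comp (em ∷ et ∷ []) (push₂R-computes _ _ _ _)

blockCode : ℕ → ℕ → ℕ
blockCode n t = letterCode sep 1 (letterCode one n t)

blockR : ∀ {n} → Rec n → Rec n → Rec n
blockR m t = letterR sep (constR 1) (letterR one m t)

blockR-computes : ∀ {n} {m t : Rec n} {xs a b} → m [ xs ]⇓ a → t [ xs ]⇓ b → blockR m t [ xs ]⇓ blockCode a b
blockR-computes {xs = xs} em et = letterR-computes sep (constR-computes 1 xs) (letterR-computes one em et)

gameOf : (p q r : Process 3 3) → StateSet p → StateSet q → StateSet r →
         LocalState p → LocalState q → LocalState r → List Msg → Instance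
gameOf p q r f g h s t u bs = record
  { nV = 3 ; nX = 3 ; nI = 3 ; prog = p ∷ q ∷ r ∷ [] ; F = f ∷ g ∷ h ∷ []
  ; c₀ = ⟨ s ∷ t ∷ u ∷ [] , bs ∷ [] ∷ [] ∷ [] , zero ∷ zero ∷ zero ∷ [] ⟩ }

gameCode : (p q r f g h s t u bs : ℕ) → ℕ
gameCode p q r f g h s t u bs = encodeList (3 ∷ 3 ∷ 3
  ∷ encodeList (p ∷ q ∷ r ∷ [])
  ∷ encodeList (f ∷ g ∷ h ∷ [])
  ∷ encodeList (s ∷ t ∷ u ∷ [])
  ∷ encodeList (bs ∷ 0 ∷ 0 ∷ [])
  ∷ encodeList (0 ∷ 0 ∷ 0 ∷ [])
  ∷ [])

gameOf-code : ∀ {I} p q r f g h s t u bs → I ≡ gameOf p q r f g h s t u bs → instanceCode I ≡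
  gameCode (processCode p) (processCode q) (processCode r) (setCode f) (setCode g) (setCode h)
           (stateCode s) (stateCode t) (stateCode u) (bufferCode bs)
gameOf-code p q r f g h s t u bs refl = trans (encode-parts (gameOf p q r f g h s t u bs))
  (assemble (processesCode₃ p q r) (setsCode₃ {p = p} {q} {r} f g h) (statesCode₃ {p = p} {q} {r} s t u) (buffersCode₃ bs) memoryCode₃)
  where
  assemble : ∀ {a a′ b b′ c c′ d d′ e e′} → a ≡ a′ → b ≡ b′ → c ≡ c′ → d ≡ d′ → e ≡ e′ →
    encodeList (3 ∷ 3 ∷ 3 ∷ a ∷ b ∷ c ∷ d ∷ e ∷ []) ≡ encodeList (3 ∷ 3 ∷ 3 ∷ a′ ∷ b′ ∷ c′ ∷ d′ ∷ e′ ∷ [])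
  assemble refl refl refl refl refl = refl

store : (a b c d : ℕ) → Store
store a b c d 0 = a
store a b c d 1 = b
store a b c d 2 = c
store a b c d 3 = d
store a b c d _ = 0

blank : ∀ n → Vec Bool n
blank n = Vec.replicate n false

-- A Gödel-style diagonal program: decide is to be the decider f applied to the code of
-- the game of this very program, which halts iff the answer is 1.
module Contrary (decide : Cmd) where

  -- The answer is in register 4. Register 5, possibly used as scratch by `decide`, is set to 1 and
  -- cleared again if the answer is nonzero; the final loop of `contrary` runs forever exactly when
  -- it is still 1.
  setup : Cmd
  setup = decide ⨟ clear 5 ⨟ inc 5 ⨟ loop 4 (clear 5)

  contrary : Cmd
  contrary = setup ⨟ loop 5 (inc 5)

  -- The machine gets the registers up to `height + 3`: enough for the program and for the four
  -- inputs. The `height` registers above the inputs start at zero, so they form a prefix of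
  -- separators in the queue.
  height : ℕ
  height = bound contrary

  open Compiled contrary (height + 3)
  open Game machine

  queueCode : List Letter → ℕ
  queueCode w = bufferCode (messages w)

  queueCode-snoc : ∀ w d → queueCode (w ++ [ d ]) ≡ letterCode d 1 (queueCode w)
  queueCode-snoc w d = trans (cong bufferCode (messages-snoc w d)) (bufferCode-letter d (messages w))

  queueCode-replicate : ∀ w d n → queueCode (w ++ replicate n d) ≡ letterCode d n (queueCode w)
  queueCode-replicate w d zero    = trans (cong queueCode (++-identityʳ w)) (sym (letterCode-zero d _))
  queueCode-replicate w d (suc n) = trans (cong queueCode (trans (cong (w ++_) (sym (push-last n))) (sym (++-assoc w _ _))))
    (trans (queueCode-snoc (w ++ replicate n d) d)
      (trans (cong (letterCode d 1) (queueCode-replicate w d n)) (letterCode-suc d n _)))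
    where
    push-last : ∀ n → replicate n d ++ [ d ] ≡ replicate (suc n) d
    push-last zero    = refl
    push-last (suc n) = cong (d ∷_) (push-last n)

  queueCode-block : ∀ w n rest → Σ (List Letter) λ w′ →
    w ++ replicate n one ++ sep ∷ rest ≡ w′ ++ rest × queueCode w′ ≡ blockCode n (queueCode w)
  queueCode-block w n rest = (w ++ replicate n one) ++ [ sep ]
    , trans (sym (++-assoc w _ _)) (sym (++-assoc (w ++ replicate n one) [ sep ] rest))
    , trans (queueCode-snoc (w ++ replicate n one) sep) (cong (letterCode sep 1) (queueCode-replicate w one n))

  blocks-high : ∀ a b c d h → blocks (store a b c d) (suc (h + 3)) ≡ replicate h sep ++ blocks (store a b c d) 4
  blocks-high a b c d zero    = refl
  blocks-high a b c d (suc h) = cong₂ (λ n w → replicate n one ++ sep ∷ w)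
    (cong (λ n → store a b c d (suc n)) (+-comm h 3)) (blocks-high a b c d h)

  blocks-code : ∀ a b c d h → queueCode (blocks (store a b c d) (suc (h + 3))) ≡
    blockCode a (blockCode b (blockCode c (blockCode d (queueCode (replicate h sep)))))
  blocks-code a b c d h =
    let w₃ , eq₃ , e₃ = queueCode-block (replicate h sep) d (blocks (store a b c d) 3)
        w₂ , eq₂ , e₂ = queueCode-block w₃ c (blocks (store a b c d) 2)
        w₁ , eq₁ , e₁ = queueCode-block w₂ b (blocks (store a b c d) 1)
        w₀ , eq₀ , e₀ = queueCode-block w₁ a []
    in trans (cong queueCode (trans (blocks-high a b c d h) (trans eq₃ (trans eq₂ (trans eq₁ (trans eq₀ (++-identityʳ w₀)))))))
         (trans e₀ (cong (blockCode a) (trans e₁ (cong (blockCode b) (trans e₂ (cong (blockCode c) e₃))))))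

  module Started (a b c d : ℕ) where

    store₀ : Store
    store₀ = store a b c d

    queue₀ : List Letter
    queue₀ = blocks store₀ (suc (height + 3))

    game : Instance
    game = gameOf senderP receiverP idlerP (plookup haltSet 𝕊) (blank _) (blank _)
             (to local-finite (start initial , nothing)) (to receiver-finite wait₀) zero (messages queue₀)

    enough : bound contrary ≤ suc (height + 3)
    enough = ≤-trans (m≤m+n height 3) (n≤1+n _)

    setup-exec : ∀ {y} → RunsTo decide 4 store₀ y → Σ Store λ ρ → Exec (decide ⨟ clear 5 ⨟ inc 5) store₀ ρ × ρ 4 ≡ y × ρ 5 ≡ 1
    setup-exec (ρ₁ , run₁ , res₁ , _) =
      let ρ₂ , run₂ , zero₂ , same₂ = clear-correct 5 ρ₁
      in ρ₂ [ 5 ↦ suc (ρ₂ 5) ] , run₁ ⨟ run₂ ⨟ inc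
       , trans (update-other ρ₂ {5} {4} (suc (ρ₂ 5)) (λ ())) (trans (same₂ 4 (λ ())) res₁)
       , trans (update-same ρ₂ 5 _) (cong suc zero₂)

    reassociate : ∀ {c₁ c₂ c₃ c₄ ρ ρ₁ ρ₂} → Exec (c₁ ⨟ c₂ ⨟ c₃) ρ ρ₁ → Exec c₄ ρ₁ ρ₂ → Exec (c₁ ⨟ c₂ ⨟ c₃ ⨟ c₄) ρ ρ₂
    reassociate (e₁ ⨟ e₂ ⨟ e₃) e₄ = e₁ ⨟ e₂ ⨟ e₃ ⨟ e₄

    accepted-loses : RunsTo decide 4 store₀ 1 → ¬ SafetyFair game
    accepted-loses runs =
      let ρ , run , ρ4 , ρ5 = setup-exec runs
          ρ₁ , run₁ , zero₁ , same₁ = clear-correct 5 (ρ [ 4 ↦ 0 ])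
          empty = trans (same₁ 4 (λ ())) (update-same ρ 4 0)
      in Halting.halting-loses machine
           (halting (reassociate run (repeat ρ4 run₁ (exit empty)) ⨟ exit zero₁) enough) refl

    rejected-wins : RunsTo decide 4 store₀ 0 → SafetyFair game
    rejected-wins runs =
      let ρ , run , ρ4 , ρ5 = setup-exec runs
      in Running.running-wins machine λ n → long-prefix
           -- Only `setup` terminates here; it is simulated up to its exit, the test `inj₂ nothing`
           -- of the final loop.
           (simulate {setup} (reassociate run (exit ρ4)) (≤-trans (m≤m⊔n (bound setup) 6) enough) {inj₁} {just (inj₂ nothing)} (λ p → refl , λ b → refl))
           (looping {5} {inj₂} {nothing} (λ ()) (≤-trans (m≤m⊔n 6 6) (≤-trans (m≤n⊔m (bound setup) 6) enough)) (λ p → refl , λ b → refl) n ρ ρ5)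

-- The argument `d` occurs twice in the buffer: as the content of register 3 and as the code of the
-- separators of the empty registers, onto which the four blocks are pushed. The receiver and the
-- idler do not depend on the machine and enter as constants.
code : (a b c d : ℕ) → ℕ
code a b c d = gameCode a (processCode receiverP) (processCode idlerP) b (setCode (blank (nQ receiverP))) (setCode (blank 1))
  c (stateCode (to receiver-finite wait₀)) (stateCode {1} zero) (blockCode a (blockCode b (blockCode c (blockCode d d))))

codeR : Rec 4
codeR = listR (constR 3 ∷ constR 3 ∷ constR 3
  ∷ listR (proj zero ∷ constR (processCode receiverP) ∷ constR (processCode idlerP) ∷ [])
  ∷ listR (proj (suc zero) ∷ constR (setCode (blank (nQ receiverP))) ∷ constR (setCode (blank 1)) ∷ [])
  ∷ listR (proj (suc (suc zero)) ∷ constR (stateCode (to receiver-finite wait₀)) ∷ constR (stateCode {1} zero) ∷ [])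
  ∷ listR (blockR (proj zero) (blockR (proj (suc zero)) (blockR (proj (suc (suc zero)))
      (blockR (proj (suc (suc (suc zero)))) (proj (suc (suc (suc zero))))))) ∷ constR 0 ∷ constR 0 ∷ [])
  ∷ listR (constR 0 ∷ constR 0 ∷ constR 0 ∷ [])
  ∷ [])

codeR-computes : ∀ a b c d → codeR [ a ∷ b ∷ c ∷ d ∷ [] ]⇓ code a b c d
codeR-computes a b c d = listR-code (const 3 ∷ const 3 ∷ const 3
  ∷ listR-code (ev-proj zero ∷ const _ ∷ const _ ∷ [])
  ∷ listR-code (ev-proj (suc zero) ∷ const _ ∷ const _ ∷ [])
  ∷ listR-code (ev-proj (suc (suc zero)) ∷ const _ ∷ const _ ∷ [])
  ∷ listR-code (blockR-computes (ev-proj zero) (blockR-computes (ev-proj (suc zero)) (blockR-computes (ev-proj (suc (suc zero)))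
      (blockR-computes (ev-proj (suc (suc (suc zero)))) (ev-proj (suc (suc (suc zero))))))) ∷ const 0 ∷ const 0 ∷ [])
  ∷ listR-code (const 0 ∷ const 0 ∷ const 0 ∷ [])
  ∷ [])
  where
  const : ∀ k → constR k [ a ∷ b ∷ c ∷ d ∷ [] ]⇓ k
  const k = constR-computes k _

decider : Rec 1 → Cmd
decider f = compile (comp f (codeR ∷ [])) (0 ∷ 1 ∷ 2 ∷ 3 ∷ []) 4

decider-correct : ∀ {f} a b c d {y} → f [ code a b c d ∷ [] ]⇓ y → RunsTo (decider f) 4 (store a b c d) y
decider-correct a b c d e = compile-correct (ev-comp (codeR-computes a b c d ∷ []) e)
  ((s≤s z≤n , refl) ∷ (s≤s (s≤s z≤n) , refl) ∷ (s≤s (s≤s (s≤s z≤n)) , refl) ∷ (s≤s (s≤s (s≤s (s≤s z≤n))) , refl) ∷ [])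

module _ (f : Rec 1) (decide : Cmd)
  (correct : ∀ a b c d {y} → f [ code a b c d ∷ [] ]⇓ y → RunsTo decide 4 (store a b c d) y) where

  open Contrary decide
  open Compiled contrary (height + 3)
  open Game machine
  -- The self-reference is closed here without circularity: the four numbers are determined by the
  -- program alone, and only the initial buffer depends on them.
  open Started (processCode senderP) (setCode (plookup haltSet 𝕊)) (stateCode (to local-finite (start initial , nothing)))
               (queueCode (replicate height sep))

  game-code : instanceCode game ≡ code (processCode senderP) (setCode (plookup haltSet 𝕊))
    (stateCode (to local-finite (start initial , nothing))) (queueCode (replicate height sep))
  game-code = trans
    (gameOf-code {game} senderP receiverP idlerP (plookup haltSet 𝕊) (blank _) (blank _)
       (to local-finite (start initial , nothing)) (to receiver-finite wait₀) zero (messages queue₀) refl)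
    (cong (gameCode (processCode senderP) (processCode receiverP) (processCode idlerP)
       (setCode (plookup haltSet 𝕊)) (setCode (blank (nQ receiverP))) (setCode (blank 1))
       (stateCode (to local-finite (start initial , nothing))) (stateCode (to receiver-finite wait₀)) (stateCode {1} zero))
       (blocks-code (processCode senderP) (setCode (plookup haltSet 𝕊)) (stateCode (to local-finite (start initial , nothing)))
          (queueCode (replicate height sep)) height))

  undecided : ¬ (∀ I → (f [ instanceCode I ∷ [] ]⇓ 1 × SafetyFair I) ⊎ (f [ instanceCode I ∷ [] ]⇓ 0 × ¬ SafetyFair I))
  undecided dec = refute (dec game)
    where
    answer : ∀ {y} → f [ instanceCode game ∷ [] ]⇓ y → RunsTo decide 4 store₀ y
    answer e = correct _ _ _ _ (subst (λ n → f [ n ∷ [] ]⇓ _) game-code e)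
    refute : ¬ ((f [ instanceCode game ∷ [] ]⇓ 1 × SafetyFair game) ⊎ (f [ instanceCode game ∷ [] ]⇓ 0 × ¬ SafetyFair game))
    refute (inj₁ (accepts , wins))  = accepted-loses (answer accepts) wins
    refute (inj₂ (rejects , loses)) = loses (rejected-wins (answer rejects))

theorem4 : ¬ Decidable SafetyFair
theorem4 decidable = let f , dec = decidable-instanceCode decidable in undecided f (decider f) decider-correct dec
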